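{- (a) There is a recursive map $u_\exists:\omega^\omega\to\omega^\omega$ such that for each $1\le\xi<\omega_1$ and each $\gamma\in BC_\xi$, $u_\exists(\gamma)\in BC_\xi$, and $x\in\rho^X[u_\exists(\gamma)]\Leftrightarrow\exists n\in\omega\ (n,x)\in\rho^{\omega\times X}(\gamma)$, for each recursively presented Polish space $X$ and each $x\in X$. (b) There is a recursive map $u_{(.)}:\omega^\omega\to\omega^\omega$ such that for each $1\le\xi<\omega_1$ and each $\gamma\in\omega^\omega$, if $(\gamma)_n\in BC_\xi$ for each $n\in\omega$, then $u_{(.)}(\gamma)\in BC_\xi$, and $x\in\rho^X[u_{(.)}(\gamma)]\Leftrightarrow\exists n\in\omega\ x\in\rho^X[(\gamma)_n]$ for each recursively presented Polish space $X$ and each $x\in X$.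
   Context: For $\gamma\in\omega^\omega$ and $i\in\omega$, $(\gamma)_i\in\omega^\omega$ is defined by $(\gamma)_i(j):=\gamma(2^i(2j+1)-1)$. Effective notions (recursively presented Polish spaces, recursive functions) are those of Moschovakis' book "Descriptive Set Theory". Each recursively presented Polish space $X$ has its standard effective enumeration $(N(X,k))_{k\in\omega}$ of a neighbourhood basis (possibly with empty sets; $N(X,0)=\emptyset$). $X$ is of type at most $1$ if it is a finite product of spaces equal to $\omega$, $\omega^\omega$ or $2^\omega$. $B\in\Sigma^0_1(X)$ iff $B=\bigcup_{i}N(X,\varepsilon(i))$ for some recursive $\varepsilon:\omega\to\omega$. A map $f:X\to Y$ is recursive if $\{(x,k)\mid f(x)\in N(Y,k)\}\in\Sigma^0_1(X\times\omega)$. Fix a good parametrization: sets $G^X\in\Sigma^0_1(\omega^\omega\times X)$, one for each recursively presented Polish $X$, such that $P\subseteq X$ is open iff $P=G^X_\gamma$ for some $\gamma\in\omega^\omega$, $P$ is $\Sigma^0_1$ iff $P=G^X_\gamma$ for some recursive $\gamma$, and for $X$ of type at most 1 and any $Y$ there is a recursive $S^{X,Y}:\omega^\omega\times X\to\omega^\omega$ with $(\gamma,x,y)\in G^{X\times Y}\Leftrightarrow(S^{X,Y}(\gamma,x),y)\in G^Y$. For $\gamma\in\omega^\omega$, $\{\gamma\}^{X,Y}$ is the partial function from $X$ to $Y$ with $\{\gamma\}^{X,Y}(x)$ defined and equal to $y$ iff $y$ is the (unique) point with $\forall k\,[y\in N(Y,k)\Leftrightarrow(\gamma,x,k)\in G^{X\times\omega}]$;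 write $\{\gamma\}$ when $Y=\omega^\omega$. Borel codes: let $\gamma^*(i):=\gamma(i+1)$. $BC_1:=\{\gamma\in\omega^\omega\mid\gamma(0)=0\}$ and for $2\le\xi<\omega_1$, $BC_\xi:=\{\gamma\in\omega^\omega\mid\gamma(0)=1$ and $\forall i\in\omega$, $\{\gamma^*\}(i)$ is defined and in $\bigcup_{1\le\eta<\xi}BC_\eta\}$; $BC:=\bigcup_{1\le\xi<\omega_1}BC_\xi$. For $\gamma\in BC$, $\rho^X(\gamma):=\bigcup_iN(X,\gamma^*(i))$ if $\gamma\in BC_1$, and $\rho^X(\gamma):=\bigcup_iX\setminus\rho^X(\{\gamma^*\}(i))$ otherwise. -}

module Defs where

open import Level using (0ℓ)
open import Data.Bool.Base using (Bool; true; false; if_then_else_)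
import Data.Bool.Properties as Bool
open import Data.Fin.Base using (Fin; zero; suc)
open import Data.Integer.Base as ℤ using (ℤ; +_; -[1+_]; +[1+_])
import Data.Integer.Properties as ℤ
open import Data.Nat.Base
open import Data.Nat.GeneralisedArithmetic using (fold)
open import Data.Nat.Properties
open import Data.Product.Base using (Σ; ∃; Σ-syntax; ∃-syntax; _×_; _,_; proj₁; proj₂; map₂)
open import Data.Product.Relation.Binary.Pointwise.NonDependent using (×-isEquivalence; Pointwise)
open import Data.Rational.Unnormalised.Base as ℚ using (ℚᵘ; mkℚᵘ; 0ℚᵘ; *<*; *≤*)
import Data.Rational.Unnormalised.Properties as ℚ
open import Data.Sum.Base as ⊎ using (_⊎_; inj₁; inj₂)
open import Data.Vec.Base using (Vec; []; _∷_; head; tail; lookup; tabulate)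
open import Function.Base using (_∘_; id; case_of_)
open import Function.Bundles using (_⇔_; mk⇔; Equivalence)
open import Relation.Binary.Core using (Rel)
open import Relation.Binary.Definitions using (DecidableEquality)
open import Relation.Binary.PropositionalEquality renaming (isEquivalence to ≡-isEquivalence)
open import Relation.Binary.Structures using (IsEquivalence)
open import Relation.Nullary using (¬_; Dec; yes; no; does; contradiction)
open import Relation.Nullary.Decidable using (map′; ¬?; _×-dec_)
open import Relation.Unary using (Pred; Decidable; _∈_; _∉_; _≐_)

open Equivalence using (to; from)

-- The least class of total functions containing the constants, the
-- successor and the projections and closed under composition, primitive
-- recursion and minimization (of functions having a zero for each value
-- of the parameters).  The last three clauses say that any h satisfying
-- the relevant equations is recursive, so the class is closed under
-- pointwise equality.

data Rec : ∀ {n} → (Vec ℕ n → ℕ) → Set where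
  const : ∀ {n} c → Rec {n} (λ _ → c)
  succ  : Rec {1} (λ v → suc (head v))
  proj  : ∀ {n} (i : Fin n) → Rec (λ v → lookup v i)
  comp  : ∀ {m n} {f : Vec ℕ m → ℕ} {g : Fin m → Vec ℕ n → ℕ} {h} →
          Rec f → (∀ i → Rec (g i)) →
          (∀ v → h v ≡ f (tabulate (λ i → g i v))) → Rec h
  prim  : ∀ {n} {f : Vec ℕ n → ℕ} {g : Vec ℕ (2 + n) → ℕ} {h} →
          Rec f → Rec g →
          (∀ v → h (0 ∷ v) ≡ f v) →
          (∀ k v → h (suc k ∷ v) ≡ g (k ∷ h (k ∷ v) ∷ v)) → Rec h
  min   : ∀ {n} {f : Vec ℕ (suc n) → ℕ} {h} → Rec f →
          (∀ v → f (h v ∷ v) ≡ 0) →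
          (∀ v k → k < h v → f (k ∷ v) ≢ 0) → Rec h

Recursive : (ℕ → ℕ) → Set
Recursive f = Rec {1} (λ v → f (head v))

RecursiveRel : ∀ {n} → Pred (Vec ℕ n) 0ℓ → Set
RecursiveRel R = Σ[ R? ∈ Decidable R ] Rec (λ v → if does (R? v) then 1 else 0)

uncurry₄ : (ℕ → ℕ → ℕ → ℕ → Set) → Pred (Vec ℕ 4) 0ℓ
uncurry₄ R (i ∷ j ∷ m ∷ k ∷ []) = R i j m k

Recursive₂ : (ℕ → ℕ → ℕ) → Set
Recursive₂ f = Rec {2} (λ v → f (lookup v zero) (lookup v (suc zero)))

ext : ∀ {n} {f h : Vec ℕ n → ℕ} → Rec f → (∀ v → h v ≡ f v) → Rec h
ext {n} {f} {h} rf e =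
  comp {f = λ v → lookup {n = 1} v zero} {g = λ _ → f} (proj zero) (λ _ → rf) e

app₁ : ∀ {n} (F : ℕ → ℕ) {f : Vec ℕ n → ℕ} →
       Recursive F → Rec f → Rec (λ v → F (f v))
app₁ F {f} rF rf = comp {g = λ _ → f} rF (λ _ → rf) (λ _ → refl)

app₂ : ∀ {n} (F : ℕ → ℕ → ℕ) {f g : Vec ℕ n → ℕ} →
       Recursive₂ F → Rec f → Rec g → Rec (λ v → F (f v) (g v))
app₂ F {f} {g} rF rf rg =
  comp {g = lookup (f ∷ g ∷ [])} rF (λ { zero → rf ; (suc zero) → rg }) (λ _ → refl)

+-rec : Recursive₂ _+_
+-rec = prim (proj zero) (app₁ suc succ (proj (suc zero)))
  (λ { (_ ∷ []) → refl }) (λ { _ (_ ∷ []) → refl })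

*-rec : Recursive₂ _*_
*-rec = prim (const 0) (app₂ _+_ +-rec (proj (suc (suc zero))) (proj (suc zero)))
  (λ { (_ ∷ []) → refl }) (λ { _ (_ ∷ []) → refl })

pred-rec : Recursive pred
pred-rec = prim (const 0) (proj zero) (λ { [] → refl }) (λ { _ [] → refl })

∸-rec : Recursive₂ _∸_
∸-rec = ext (app₂ (λ m n → n ∸ m) flipped (proj (suc zero)) (proj zero)) (λ _ → refl)
  where
  ∸-suc : ∀ n k → n ∸ suc k ≡ pred (n ∸ k)
  ∸-suc n k = sym (pred[m∸n]≡m∸[1+n] n k)
  flipped : Recursive₂ (λ m n → n ∸ m)
  flipped = prim (proj zero) (app₁ pred pred-rec (proj (suc zero)))
    (λ { (_ ∷ []) → refl }) (λ { k (n ∷ []) → ∸-suc n k })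

fold-rec : ∀ (s : ℕ → ℕ) → Recursive s → Recursive₂ (λ k n → fold n s k)
fold-rec s rs = prim (proj zero) (app₁ s rs (proj (suc zero)))
  (λ { (_ ∷ []) → refl }) (λ { _ (_ ∷ []) → refl })

∑ : (ℕ → ℕ) → ℕ → ℕ
∑ f zero    = 0
∑ f (suc n) = f n + ∑ f n

∑-rec : ∀ {n} {f : Vec ℕ (suc n) → ℕ} {b : Vec ℕ n → ℕ} → Rec f → Rec b →
        Rec (λ v → ∑ (λ k → f (k ∷ v)) (b v))
∑-rec {n} {f} {b} rf rb =
  comp {f = λ v → ∑ (λ k → f (k ∷ tail v)) (head v)}
       {g = λ { zero → b ; (suc i) → λ v → lookup v i }}
    (prim (const 0)
      (app₂ _+_ +-rec
        (comp {g = λ { zero → λ v → lookup v zero ; (suc i) → λ v → lookup v (suc (suc i)) }} rf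
          (λ { zero → proj zero ; (suc i) → proj (suc (suc i)) }) (λ _ → refl))
        (proj (suc zero)))
      (λ _ → refl)
      (λ k v → cong (λ w → f (k ∷ w) + ∑ (λ j → f (j ∷ v)) k) (sym (tab∘lookup v))))
    (λ { zero → rb ; (suc i) → proj i })
    (λ v → cong (λ w → ∑ (λ k → f (k ∷ w)) (b v)) (sym (tab∘lookup v)))
  where
  tab∘lookup : ∀ {m} (v : Vec ℕ m) → tabulate (lookup v) ≡ v
  tab∘lookup []      = refl
  tab∘lookup (x ∷ v) = cong (x ∷_) (tab∘lookup v)

record ZeroSet {n} (R : Pred (Vec ℕ n) 0ℓ) : Set where
  constructor zeroSet
  field
    {fun}  : Vec ℕ n → ℕ
    rec    : Rec fun
    spec   : ∀ v → R v ⇔ fun v ≡ 0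

toRel : ∀ {n} {R : Pred (Vec ℕ n) 0ℓ} → ZeroSet R → RecursiveRel R
toRel {R = R} (zeroSet {f} rf e) = R? , ext (app₂ _∸_ ∸-rec (const 1) rf) ind
  where
  R? : Decidable R
  R? v = map′ (from (e v)) (to (e v)) (f v ≟ 0)
  ind : ∀ v → (if does (R? v) then 1 else 0) ≡ 1 ∸ f v
  ind v with f v
  ... | zero  = refl
  ... | suc m = sym (0∸n≡0 m)

fromRel : ∀ {n} {R : Pred (Vec ℕ n) 0ℓ} → RecursiveRel R → ZeroSet R
fromRel {R = R} (R? , r) = zeroSet (app₂ _∸_ ∸-rec (const 1) r) e
  where
  e : ∀ v → R v ⇔ 1 ∸ (if does (R? v) then 1 else 0) ≡ 0
  e v with R? v
  ... | yes p = mk⇔ (λ _ → refl) (λ _ → p)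
  ... | no ¬p = mk⇔ (λ p → contradiction p ¬p) (λ ())

Z-resp : ∀ {n} {R R′ : Pred (Vec ℕ n) 0ℓ} → ZeroSet R → (∀ v → R′ v ⇔ R v) → ZeroSet R′
Z-resp (zeroSet r e) i = zeroSet r (λ v → mk⇔ (to (e v) ∘ to (i v)) (from (i v) ∘ from (e v)))

Z-≤ : ∀ {n} {f g : Vec ℕ n → ℕ} → Rec f → Rec g → ZeroSet (λ v → f v ≤ g v)
Z-≤ rf rg = zeroSet (app₂ _∸_ ∸-rec rf rg) (λ v → mk⇔ m≤n⇒m∸n≡0 m∸n≡0⇒m≤n)

Z-× : ∀ {n} {R R′ : Pred (Vec ℕ n) 0ℓ} → ZeroSet R → ZeroSet R′ → ZeroSet (λ v → R v × R′ v)
Z-× (zeroSet {f} r e) (zeroSet {f′} r′ e′) = zeroSet (app₂ _+_ +-rec r r′) λ v → mk⇔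
  (λ { (p , p′) → cong₂ _+_ (to (e v) p) (to (e′ v) p′) })
  (λ z → from (e v) (m+n≡0⇒m≡0 (f v) z) , from (e′ v) (m+n≡0⇒n≡0 (f v) z))

Z-⊎ : ∀ {n} {R R′ : Pred (Vec ℕ n) 0ℓ} → ZeroSet R → ZeroSet R′ → ZeroSet (λ v → R v ⊎ R′ v)
Z-⊎ (zeroSet {f} r e) (zeroSet {f′} r′ e′) = zeroSet (app₂ _*_ *-rec r r′) λ v → mk⇔
  (λ { (inj₁ p) → cong (_* f′ v) (to (e v) p)
     ; (inj₂ p) → trans (cong (f v *_) (to (e′ v) p)) (*-zeroʳ (f v)) })
  (λ z → ⊎.map (from (e v)) (from (e′ v)) (m*n≡0⇒m≡0∨n≡0 (f v) z))

Z-∀ : ∀ {n} {R : Pred (Vec ℕ (suc n)) 0ℓ} {b : Vec ℕ n → ℕ} → ZeroSet R → Rec b →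
      ZeroSet (λ v → ∀ k → k < b v → R (k ∷ v))
Z-∀ {b = b} (zeroSet {f} r e) rb = zeroSet (∑-rec r rb) λ v → mk⇔
  (λ h → all⇒∑ (λ k → f (k ∷ v)) (b v) (λ k k<b → to (e (k ∷ v)) (h k k<b)))
  (λ z k k<b → from (e (k ∷ v)) (∑⇒all (λ k → f (k ∷ v)) (b v) z k k<b))
  where
  all⇒∑ : ∀ g n → (∀ k → k < n → g k ≡ 0) → ∑ g n ≡ 0
  all⇒∑ g zero    h = refl
  all⇒∑ g (suc n) h = cong₂ _+_ (h n ≤-refl) (all⇒∑ g n (λ k k<n → h k (m<n⇒m<1+n k<n)))
  ∑⇒all : ∀ g n → ∑ g n ≡ 0 → ∀ k → k < n → g k ≡ 0
  ∑⇒all g (suc n) z k (s≤s k≤n) with m≤n⇒m<n∨m≡n k≤n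
  ... | inj₁ k<n  = ∑⇒all g n (m+n≡0⇒n≡0 (g n) z) k k<n
  ... | inj₂ refl = m+n≡0⇒m≡0 (g n) z

Z-subst : ∀ {m n} {R : Pred (Vec ℕ m) 0ℓ} (g : Fin m → Vec ℕ n → ℕ) →
          ZeroSet R → (∀ i → Rec (g i)) → ZeroSet (λ v → R (tabulate (λ i → g i v)))
Z-subst g (zeroSet {f} r e) rg = zeroSet (comp {f = f} {g = g} r rg (λ _ → refl)) (λ v → e _)

-- The bijection used to define (γ)ᵢ; it also replaces the prime power coding
-- in the enumerations of dense sequences and of basic neighbourhoods.
pair : ℕ → ℕ → ℕ
pair i j = 2 ^ i * (2 * j + 1) ∸ 1

odd : ℕ → ℕ
odd zero    = 0
odd (suc n) = 1 ∸ odd n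

-- pair i j has j doubled below i binary digits 1, so i is the number of
-- halvings needed to reach an even number; the fuel n suffices.
ones : ℕ → ℕ → ℕ
ones zero    n = 0
ones (suc k) n = if odd n ≡ᵇ 0 then 0 else suc (ones k ⌊ n /2⌋)

π₁ π₂ : ℕ → ℕ
π₁ n = ones n n
π₂ n = ⌊ fold n ⌊_/2⌋ (π₁ n) /2⌋

-- The i-th eventually zero sequence.
entry : ℕ → ℕ → ℕ
entry i n = π₁ (fold i π₂ n)

fold-shift : ∀ (s : ℕ → ℕ) z k → fold z s (suc k) ≡ fold (s z) s k
fold-shift s z zero    = refl
fold-shift s z (suc k) = cong s (fold-shift s z k)

odd-cases : ∀ n → odd n ≡ 0 ⊎ odd n ≡ 1
odd-cases zero    = inj₁ refl
odd-cases (suc n) with odd n | odd-cases n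
... | _ | inj₁ refl = inj₂ refl
... | _ | inj₂ refl = inj₁ refl

odd-2* : ∀ n → odd (n + n) ≡ 0
odd-2* zero    = refl
odd-2* (suc n) rewrite +-suc n n | odd-2* n = refl

half-2* : ∀ n → ⌊ n + n /2⌋ ≡ n
half-2* zero    = refl
half-2* (suc n) rewrite +-suc n n = cong suc (half-2* n)

half-1+2* : ∀ n → ⌊ suc (n + n) /2⌋ ≡ n
half-1+2* zero    = refl
half-1+2* (suc n) rewrite +-suc n n = cong suc (half-1+2* n)

pair-zero : ∀ j → pair 0 j ≡ j + j
pair-zero j rewrite +-identityʳ (2 * j + 1) | +-comm (2 * j) 1 | +-identityʳ j = refl

pair-suc : ∀ i j → pair (suc i) j ≡ suc (pair i j + pair i j)
pair-suc i j = trans (cong (_∸ 1) (*-assoc 2 (2 ^ i) (2 * j + 1))) (go (2 ^ i * (2 * j + 1)) pos)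
  where
  pos : 1 ≤ 2 ^ i * (2 * j + 1)
  pos = *-mono-≤ (m^n>0 2 i) (m≤n+m 1 (2 * j))
  go : ∀ a → 1 ≤ a → 2 * a ∸ 1 ≡ suc ((a ∸ 1) + (a ∸ 1))
  go (suc a) _ rewrite +-identityʳ a = +-suc a a

private
  ones-pair : ∀ k i j → pair i j ≤ k → ones k (pair i j) ≡ i
  ones-pair zero    zero    j le = refl
  ones-pair (suc k) zero    j le rewrite pair-zero j | odd-2* j = refl
  ones-pair k       (suc i) j le rewrite pair-suc i j with k | le
  ... | suc k′ | s≤s le′ rewrite odd-2* (pair i j) | half-1+2* (pair i j) =
    cong suc (ones-pair k′ i j (≤-trans (m≤m+n _ _) le′))

  fold-pair : ∀ i j → fold (pair i j) ⌊_/2⌋ i ≡ j + j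
  fold-pair zero    j = pair-zero j
  fold-pair (suc i) j rewrite fold-shift ⌊_/2⌋ (pair (suc i) j) i | pair-suc i j
    | half-1+2* (pair i j) = fold-pair i j

π₁-pair : ∀ i j → π₁ (pair i j) ≡ i
π₁-pair i j = ones-pair _ i j ≤-refl

π₂-pair : ∀ i j → π₂ (pair i j) ≡ j
π₂-pair i j rewrite π₁-pair i j | fold-pair i j = half-2* j

odd-rec : Recursive odd
odd-rec = prim (const 0) (app₂ _∸_ ∸-rec (const 1) (proj (suc zero)))
  (λ { [] → refl }) (λ { _ [] → refl })

half-rec : Recursive ⌊_/2⌋
half-rec = prim (const 0) (app₂ _+_ +-rec (app₁ odd odd-rec (proj zero)) (proj (suc zero)))
  (λ { [] → refl }) (λ { k [] → step k })
  where
  step : ∀ k → ⌊ suc k /2⌋ ≡ odd k + ⌊ k /2⌋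
  step zero          = refl
  step (suc zero)    = refl
  step (suc (suc k)) with odd k | odd-cases k | step k
  ... | _ | inj₁ refl | e = cong suc e
  ... | _ | inj₂ refl | e = cong suc e

private
  half≤ : ∀ n → ⌊ n /2⌋ ≤ pred n
  half≤ zero          = z≤n
  half≤ (suc zero)    = z≤n
  half≤ (suc (suc n)) = s≤s (≤-trans (half≤ n) pred[n]≤n)

  ones-zero : ∀ k n → n ≤ k → odd (fold n ⌊_/2⌋ (ones k n)) ≡ 0
  ones-zero zero    zero le = refl
  ones-zero (suc k) n    le with odd n in eq | odd-cases n
  ... | _ | inj₁ refl = eq
  ... | _ | inj₂ refl rewrite fold-shift ⌊_/2⌋ n (ones k ⌊ n /2⌋) =
    ones-zero k ⌊ n /2⌋ (≤-trans (half≤ n) (pred-mono-≤ le))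

  ones-least : ∀ k n i → i < ones k n → odd (fold n ⌊_/2⌋ i) ≢ 0
  ones-least (suc k) n i       lt z with odd n in eq | odd-cases n
  ones-least (suc k) n i       ()        z | _ | inj₁ refl
  ones-least (suc k) n zero    lt        z | _ | inj₂ refl with () ← trans (sym eq) z
  ones-least (suc k) n (suc i) (s≤s lt)  z | _ | inj₂ refl rewrite fold-shift ⌊_/2⌋ n i =
    ones-least k ⌊ n /2⌋ i lt z

π₁-rec : Recursive π₁
π₁-rec = min (app₁ odd odd-rec (fold-rec ⌊_/2⌋ half-rec))
  (λ { (n ∷ []) → ones-zero n n ≤-refl }) (λ { (n ∷ []) k → ones-least n n k })

π₂-rec : Recursive π₂
π₂-rec = ext (app₁ ⌊_/2⌋ half-rec (app₂ (λ k n → fold n ⌊_/2⌋ k) (fold-rec ⌊_/2⌋ half-rec) (app₁ π₁ π₁-rec (proj zero)) (proj zero)))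
  (λ { (_ ∷ []) → refl })

entry-rec : Recursive₂ entry
entry-rec = app₁ π₁ π₁-rec (app₂ (λ k n → fold n π₂ k) (fold-rec π₂ π₂-rec) (proj (suc zero)) (proj zero))

π₂≤ : ∀ n → π₂ n ≤ pred n
π₂≤ n = ≤-trans (half≤ _) (pred-mono-≤ (fold≤ (π₁ n)))
  where
  fold≤ : ∀ k → fold n ⌊_/2⌋ k ≤ n
  fold≤ zero    = ≤-refl
  fold≤ (suc k) = ≤-trans (half≤ _) (≤-trans pred[n]≤n (fold≤ k))

entry-zero : ∀ i n → i ≤ n → entry i n ≡ 0
entry-zero i n i≤n = cong π₁ (n≤0⇒n≡0 (≤-trans (fold≤ n) (≤-reflexive (m≤n⇒m∸n≡0 i≤n))))
  where
  fold≤ : ∀ k → fold i π₂ k ≤ i ∸ k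
  fold≤ zero    = ≤-refl
  fold≤ (suc k) = ≤-trans (π₂≤ (fold i π₂ k))
    (≤-trans (pred-mono-≤ (fold≤ k)) (≤-reflexive (pred[m∸n]≡m∸[1+n] i k)))

code : (ℕ → ℕ) → ℕ → ℕ
code x zero    = 0
code x (suc n) = pair (x 0) (code (x ∘ suc) n)

entry-code : ∀ x n k → k < n → entry (code x n) k ≡ x k
entry-code x (suc n) zero    _         = π₁-pair (x 0) (code (x ∘ suc) n)
entry-code x (suc n) (suc k) (s≤s k<n) = trans
  (cong π₁ (trans (fold-shift π₂ (code x (suc n)) k)
                  (cong (λ c → fold c π₂ k) (π₂-pair (x 0) (code (x ∘ suc) n)))))
  (entry-code (x ∘ suc) n k k<n)

-- Dedekind cuts.
record ℝ : Set₁ where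
  field
    lower upper     : Pred ℚᵘ 0ℓ
    lower-inhabited : ∃ lower
    upper-inhabited : ∃ upper
    lower-rounded   : ∀ q → lower q ⇔ (∃[ r ] q ℚ.< r × lower r)
    upper-rounded   : ∀ q → upper q ⇔ (∃[ p ] p ℚ.< q × upper p)
    disjoint        : ∀ q → ¬ (lower q × upper q)
    located         : ∀ {p q} → p ℚ.< q → lower p ⊎ upper q

open ℝ

infix 4 _≤ᴿ_ _≃ᴿ_ _<ℚ_ _≤ℚ_

_<ℚ_ _≤ℚ_ : ℝ → ℚᵘ → Set
x <ℚ q = upper x q
x ≤ℚ q = ¬ lower x q

_≤ᴿ_ _≃ᴿ_ : ℝ → ℝ → Set
x ≤ᴿ y = ∀ q → y <ℚ q → x <ℚ q
x ≃ᴿ y = x ≤ᴿ y × y ≤ᴿ x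

-- x ≤ y + z, where (y + z) < r iff r = p + q with y < p and z < q.
_≤ᴿ_⊹_ : ℝ → ℝ → ℝ → Set
x ≤ᴿ y ⊹ z = ∀ p q → y <ℚ p → z <ℚ q → x <ℚ (p ℚ.+ q)

0ᴿ : ℝ
0ᴿ = record
  { lower           = ℚ._< 0ℚᵘ
  ; upper           = 0ℚᵘ ℚ.<_
  ; lower-inhabited = mkℚᵘ -[1+ 0 ] 0 , *<* ℤ.-<+
  ; upper-inhabited = mkℚᵘ (+ 1) 0 , *<* (ℤ.+<+ (s≤s z≤n))
  ; lower-rounded   = λ q → mk⇔ ℚ.<-dense (λ { (_ , a , b) → ℚ.<-trans a b })
  ; upper-rounded   = λ q → mk⇔ (λ h → let m , a , b = ℚ.<-dense h in m , b , a)
                               (λ { (_ , a , b) → ℚ.<-trans b a })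
  ; disjoint        = λ q (a , b) → ℚ.<-asym a b
  ; located         = loc
  }
  where
  loc : ∀ {p q} → p ℚ.< q → p ℚ.< 0ℚᵘ ⊎ 0ℚᵘ ℚ.< q
  loc {p} p<q with p ℚ.<? 0ℚᵘ
  ... | yes h = inj₁ h
  ... | no h  = inj₂ (ℚ.≤-<-trans (ℚ.≮⇒≥ h) p<q)

_⊔ᴿ_ : ℝ → ℝ → ℝ
x ⊔ᴿ y = record
  { lower           = λ q → lower x q ⊎ lower y q
  ; upper           = λ q → upper x q × upper y q
  ; lower-inhabited = map₂ inj₁ (lower-inhabited x)
  ; upper-inhabited = let p , up = upper-inhabited x ; q , uq = upper-inhabited y in
      p ℚ.⊔ q , weaken x (ℚ.p≤p⊔q p q) up , weaken y (ℚ.p≤q⊔p p q) uq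
  ; lower-rounded   = λ q → mk⇔
      (λ { (inj₁ l) → let r , a , b = to (lower-rounded x q) l in r , a , inj₁ b
         ; (inj₂ l) → let r , a , b = to (lower-rounded y q) l in r , a , inj₂ b })
      (λ { (r , a , inj₁ b) → inj₁ (from (lower-rounded x q) (r , a , b))
         ; (r , a , inj₂ b) → inj₂ (from (lower-rounded y q) (r , a , b)) })
  ; upper-rounded   = λ q → mk⇔
      (λ { (u , v) → let p , a , b = to (upper-rounded x q) u
                         r , c , d = to (upper-rounded y q) v
                     in p ℚ.⊔ r , lub a c , weaken x (ℚ.p≤p⊔q p r) b , weaken y (ℚ.p≤q⊔p p r) d })
      (λ { (r , a , b , c) → from (upper-rounded x q) (r , a , b) , from (upper-rounded y q) (r , a , c) })
  ; disjoint        = λ { q (inj₁ l , u , _) → disjoint x q (l , u)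
                        ; q (inj₂ l , _ , u) → disjoint y q (l , u) }
  ; located         = loc
  }
  where
  weaken : ∀ (z : ℝ) {p q} → p ℚ.≤ q → upper z p → upper z q
  weaken z {p} {q} p≤q u = let r , a , b = to (upper-rounded z p) u in
    from (upper-rounded z q) (r , ℚ.<-≤-trans a p≤q , b)
  lub : ∀ {p r q} → p ℚ.< q → r ℚ.< q → p ℚ.⊔ r ℚ.< q
  lub {p} {r} a b with ℚ.⊔-sel p r
  ... | inj₁ e = ℚ.<-respˡ-≃ (ℚ.≃-sym e) a
  ... | inj₂ e = ℚ.<-respˡ-≃ (ℚ.≃-sym e) b
  loc : ∀ {p q} → p ℚ.< q → (lower x p ⊎ lower y p) ⊎ (upper x q × upper y q)
  loc h with located x h | located y h
  ... | inj₁ l | _      = inj₁ (inj₁ l)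
  ... | _      | inj₁ l = inj₁ (inj₂ l)
  ... | inj₂ u | inj₂ v = inj₂ (u , v)

1/1+_ : ℕ → ℚᵘ
1/1+ n = mkℚᵘ (+ 1) n

1/1+-pos : ∀ n → 0ℚᵘ ℚ.< 1/1+ n
1/1+-pos n = *<* (ℤ.+<+ (s≤s z≤n))

1/1+-anti : ∀ {m n} → m ≤ n → 1/1+ n ℚ.≤ 1/1+ m
1/1+-anti {m} {n} m≤n = *≤* (ℤ.+≤+ (s≤s (+-monoˡ-≤ 0 m≤n)))

archimedean : ∀ {q} → 0ℚᵘ ℚ.< q → ∃[ n ] 1/1+ n ℚ.< q
archimedean {mkℚᵘ +[1+ a ] d} _ = suc d ,
  *<* (ℤ.+<+ (≤-trans (≤-reflexive (cong suc (+-identityʳ (suc d)))) (m≤m+n (suc (suc d)) (a * suc (suc d)))))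
archimedean {mkℚᵘ (+ 0) d}     (*<* (ℤ.+<+ ()))
archimedean {mkℚᵘ -[1+ a ] d}  (*<* ())

private
  +-pos : ∀ {p q} → 0ℚᵘ ℚ.< p → 0ℚᵘ ℚ.< q → q ℚ.< p ℚ.+ q
  +-pos {p} {q} h _ = ℚ.<-respˡ-≃ (ℚ.+-identityˡ q) (ℚ.+-monoˡ-< q h)

  +-posʳ : ∀ {p q} → 0ℚᵘ ℚ.< p → 0ℚᵘ ℚ.< q → p ℚ.< p ℚ.+ q
  +-posʳ {p} {q} h k = ℚ.<-respʳ-≃ (ℚ.+-comm q p) (+-pos k h)

  -- the least element of D below N, if any
  search : ∀ {D : ℕ → Set} → (∀ n → Dec (D n)) → ∀ N →
           (∃[ n ] D n × (∀ k → D k → n ≤ k)) ⊎ (∀ k → D k → N ≤ k)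
  search D? zero    = inj₂ (λ _ _ → z≤n)
  search D? (suc N) with search D? N
  ... | inj₁ h = inj₁ h
  ... | inj₂ h with D? N
  ...   | yes d = inj₁ (N , d , h)
  ...   | no ¬d = inj₂ (λ k dk → ≤∧≢⇒< (h k dk) (λ { refl → ¬d dk }))

-- The greatest 1/(n+1) with n ∈ D, and 0 if D is empty.
gap : ∀ {D : ℕ → Set} → (∀ n → Dec (D n)) → ℝ
gap {D} D? = record
  { lower           = Low
  ; upper           = Up
  ; lower-inhabited = mkℚᵘ -[1+ 0 ] 0 , inj₁ (*<* ℤ.-<+)
  ; upper-inhabited = mkℚᵘ (+ 2) 0 , *<* (ℤ.+<+ (s≤s z≤n)) ,
                      λ n _ → *<* (ℤ.+<+ (s≤s (≤-trans (s≤s z≤n) (m≤n+m (1 * suc n) n))))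
  ; lower-rounded   = λ q → mk⇔
      (λ { (inj₁ h) → let m , a , b = ℚ.<-dense h in m , a , inj₁ b
         ; (inj₂ (n , d , h)) → let m , a , b = ℚ.<-dense h in m , a , inj₂ (n , d , b) })
      (λ { (r , a , inj₁ h) → inj₁ (ℚ.<-trans a h)
         ; (r , a , inj₂ (n , d , h)) → inj₂ (n , d , ℚ.<-trans a h) })
  ; upper-rounded   = λ q → mk⇔ (rounded q)
      (λ { (p , a , u , v) → ℚ.<-trans u a , λ n d → ℚ.<-trans (v n d) a })
  ; disjoint        = λ { q (inj₁ h , u , _) → ℚ.<-asym h u
                        ; q (inj₂ (n , d , h) , _ , v) → ℚ.<-asym h (v n d) }
  ; located         = loc
  }
  where
  Low Up : ℚᵘ → Set
  Low q = q ℚ.< 0ℚᵘ ⊎ (∃[ n ] D n × q ℚ.< 1/1+ n)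
  Up  q = 0ℚᵘ ℚ.< q × (∀ n → D n → 1/1+ n ℚ.< q)

  fromBound : ∀ {q} n → 1/1+ n ℚ.< q → (∀ k → D k → n ≤ k) → Up q
  fromBound n h b = ℚ.<-trans (1/1+-pos n) h , λ k d → ℚ.≤-<-trans (1/1+-anti (b k d)) h

  toBound : ∀ q → Up q → ∃[ n ] (1/1+ n ℚ.< q) × (∀ k → D k → n ≤ k)
  toBound q (u , v) with archimedean u
  ... | N , h with search D? N
  ...   | inj₁ (n , d , b) = n , v n d , b
  ...   | inj₂ b           = N , h , b

  rounded : ∀ q → Up q → ∃[ p ] p ℚ.< q × Up p
  rounded q u with toBound q u
  ... | n , h , b with ℚ.<-dense h
  ...   | p , a , c = p , c , fromBound n a b

  loc : ∀ {p q} → p ℚ.< q → Low p ⊎ Up q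
  loc {p} {q} p<q with 0ℚᵘ ℚ.<? q
  ... | no ¬h = inj₁ (inj₁ (ℚ.<-≤-trans p<q (ℚ.≮⇒≥ ¬h)))
  ... | yes h with archimedean h
  ...   | N , a with search D? N
  ...     | inj₂ b = inj₂ (fromBound N a b)
  ...     | inj₁ (n , d , b) with p ℚ.<? 1/1+ n
  ...       | yes l = inj₁ (inj₂ (n , d , l))
  ...       | no ¬l = inj₂ (fromBound n (ℚ.≤-<-trans (ℚ.≮⇒≥ ¬l) p<q) b)

-- A complete separable metric space with a recursive presentation r; _≈_ is
-- equality of points.  Neighbourhoods depend on d and r, not only on the
-- topology.
record Space : Set₁ where
  infix 4 _≈_
  field
    Carrier       : Set
    _≈_           : Rel Carrier 0ℓ
    isEquivalence : IsEquivalence _≈_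
    d             : Carrier → Carrier → ℝ
    d-nonneg      : ∀ x y → 0ᴿ ≤ᴿ d x y
    d-zero        : ∀ x y → d x y ≃ᴿ 0ᴿ ⇔ x ≈ y
    d-sym         : ∀ x y → d x y ≤ᴿ d y x
    d-triangle    : ∀ x y z → d x z ≤ᴿ d x y ⊹ d y z

  Cauchy : (ℕ → Carrier) → Set
  Cauchy s = ∀ ε → 0ℚᵘ ℚ.< ε → ∃[ N ] (∀ m n → N ≤ m → N ≤ n → d (s m) (s n) <ℚ ε)

  ConvergesTo : (ℕ → Carrier) → Carrier → Set
  ConvergesTo s x = ∀ ε → 0ℚᵘ ℚ.< ε → ∃[ N ] (∀ n → N ≤ n → d (s n) x <ℚ ε)

  field
    complete : ∀ s → Cauchy s → ∃[ x ] ConvergesTo s x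
    r        : ℕ → Carrier
    r-dense  : ∀ x ε → 0ℚᵘ ℚ.< ε → ∃[ i ] d x (r i) <ℚ ε
    <-recursive : RecursiveRel (uncurry₄ λ i j m k → d (r i) (r j) <ℚ (+ m ℚ./ suc k))
    ≤-recursive : RecursiveRel (uncurry₄ λ i j m k → d (r i) (r j) ≤ℚ (+ m ℚ./ suc k))

open Space using (Carrier)

-- The ball of centre r_{(s)₀} and radius (s)₁ / ((s)₂ + 1), where s codes the
-- triple (s)₀, (s)₁, (s)₂.  The radius is 0 for s = 0, so N X 0 is empty.
N : (X : Space) → ℕ → Pred (Carrier X) 0ℓ
N X s x = d (r (π₁ s)) x <ℚ (+ π₁ (π₂ s) ℚ./ suc (π₂ (π₂ s)))
  where open Space X

Open : (X : Space) → Pred (Carrier X) 0ℓ → Set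
Open X P = ∀ x → P x → ∃[ ε ] 0ℚᵘ ℚ.< ε × (∀ y → d x y <ℚ ε → P y)
  where open Space X

private
  1/1+<⇔ : ∀ n m k → 1/1+ n ℚ.< mkℚᵘ (+ m) k ⇔ suc (suc k) ≤ m * suc n
  1/1+<⇔ n m k = mk⇔
    (λ { (*<* h) → let h′ = subst₂ ℤ._<_ (ℤ.*-identityˡ (+ suc k)) (sym (ℤ.pos-* m (suc n))) h in ℤ.drop‿+<+ h′ })
    (λ h → *<* (subst₂ ℤ._<_ (sym (ℤ.*-identityˡ (+ suc k))) (ℤ.pos-* m (suc n)) (ℤ.+<+ h)))

  1/1+≤⇔ : ∀ n m k → 1/1+ n ℚ.≤ mkℚᵘ (+ m) k ⇔ suc k ≤ m * suc n
  1/1+≤⇔ n m k = mk⇔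
    (λ { (*≤* h) → let h′ = subst₂ ℤ._≤_ (ℤ.*-identityˡ (+ suc k)) (sym (ℤ.pos-* m (suc n))) h in ℤ.drop‿+≤+ h′ })
    (λ h → *≤* (subst₂ ℤ._≤_ (sym (ℤ.*-identityˡ (+ suc k))) (ℤ.pos-* m (suc n)) (ℤ.+≤+ h)))

  0<⇔ : ∀ m k → 0ℚᵘ ℚ.< mkℚᵘ (+ m) k ⇔ 1 ≤ m
  0<⇔ m k = mk⇔
    (λ { (*<* h) → ℤ.drop‿+<+ (subst (ℤ._<_ (+ 0)) (ℤ.*-identityʳ (+ m)) h) })
    (λ h → *<* (subst (ℤ._<_ (+ 0)) (sym (ℤ.*-identityʳ (+ m))) (ℤ.+<+ h)))

  0≤ : ∀ m k → 0ℚᵘ ℚ.≤ mkℚᵘ (+ m) k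
  0≤ m k = *≤* (subst (ℤ._≤_ (+ 0)) (sym (ℤ.*-identityʳ (+ m))) (ℤ.+≤+ z≤n))

  v₀ : ∀ {n} → Fin (1 + n)
  v₁ : ∀ {n} → Fin (2 + n)
  v₂ : ∀ {n} → Fin (3 + n)
  v₃ : ∀ {n} → Fin (4 + n)
  v₄ : ∀ {n} → Fin (5 + n)
  v₀ = zero
  v₁ = suc v₀
  v₂ = suc v₁
  v₃ = suc v₂
  v₄ = suc v₃

module _ {A : Set} (_≟ᴬ_ : DecidableEquality A)
         (dec : ℕ → A) (enc : A → ℕ) (dec∘enc : ∀ a → dec (enc a) ≡ a)
         (rec : Recursive (enc ∘ dec)) where

  private
    D : (x y : ℕ → A) → ℕ → Set
    D x y n = x n ≢ y n

    D? : ∀ x y n → Dec (D x y n)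
    D? x y n = ¬? (x n ≟ᴬ y n)

    dist : (x y : ℕ → A) → ℝ
    dist x y = gap (D? x y)

    point : ℕ → ℕ → A
    point i = dec ∘ entry i

    ¬¬≡ : ∀ {a b} → ¬ (a ≢ b) → a ≡ b
    ¬¬≡ {a} {b} h with a ≟ᴬ b
    ... | yes e = e
    ... | no ne = contradiction ne h

    close : ∀ x y n → dist x y <ℚ (1/1+ n) → ∀ k → k ≤ n → x k ≡ y k
    close x y n (_ , v) k k≤n = ¬¬≡ λ ne →
      ℚ.<-irrefl ℚ.≃-refl (ℚ.<-≤-trans (v k ne) (1/1+-anti k≤n))

    near : ∀ x y n ε → 1/1+ n ℚ.< ε → (∀ k → k ≤ n → x k ≡ y k) → dist x y <ℚ ε
    near x y n ε h e = ℚ.<-trans (1/1+-pos n) h , λ k ne →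
      ℚ.≤-<-trans (1/1+-anti (<⇒≤ (≰⇒> (λ k≤n → ne (e k k≤n))))) h

    zeroʳ : ∀ x y → dist x y ≃ᴿ 0ᴿ ⇔ (∀ n → x n ≡ y n)
    zeroʳ x y = mk⇔
      (λ (h , _) n → close x y n (h (1/1+ n) (1/1+-pos n)) n ≤-refl)
      (λ e → (λ q h → h , λ n ne → contradiction (e n) ne) , λ q → proj₁)

    triangle : ∀ x y z → dist x z ≤ᴿ dist x y ⊹ dist y z
    triangle x y z p q (u , v) (u′ , v′) = ℚ.<-trans u′ (+-pos u u′) , λ n ne →
      case x n ≟ᴬ y n of λ
        { (yes e) → ℚ.<-trans (v′ n (λ e′ → ne (trans e e′))) (+-pos u u′)
        ; (no  h) → ℚ.<-trans (v n h) (+-posʳ u u′) }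

    CauchySeq : (ℕ → ℕ → A) → Set
    CauchySeq s = ∀ ε → 0ℚᵘ ℚ.< ε → ∃[ K ] (∀ m n → K ≤ m → K ≤ n → dist (s m) (s n) <ℚ ε)

    ConvTo : (ℕ → ℕ → A) → (ℕ → A) → Set
    ConvTo s x = ∀ ε → 0ℚᵘ ℚ.< ε → ∃[ K ] (∀ n → K ≤ n → dist (s n) x <ℚ ε)

    compl : ∀ s → CauchySeq s → ∃[ x ] ConvTo s x
    compl s c = (λ n → s (K n) n) , λ ε h →
        let n , a = archimedean h in
        ∑ K (suc n) , λ m le → near (s m) _ n ε a λ k k≤n →
          close (s m) (s (K k)) k
            (proj₂ (c (1/1+ k) (1/1+-pos k)) m (K k)
              (≤-trans (K≤∑ k (suc n) (s≤s k≤n)) le) ≤-refl)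
            k ≤-refl
      where
      K : ℕ → ℕ
      K n = proj₁ (c (1/1+ n) (1/1+-pos n))
      K≤∑ : ∀ k n → k < n → K k ≤ ∑ K n
      K≤∑ k (suc n) (s≤s k≤n) with m≤n⇒m<n∨m≡n k≤n
      ... | inj₁ k<n  = ≤-trans (K≤∑ k n k<n) (m≤n+m _ (K n))
      ... | inj₂ refl = m≤m+n (K k) _

    dense : ∀ x ε → 0ℚᵘ ℚ.< ε → ∃[ i ] dist x (point i) <ℚ ε
    dense x ε h = let n , a = archimedean h in
      code (enc ∘ x) (suc n) , near x _ n ε a λ k k≤n →
        sym (trans (cong dec (entry-code (enc ∘ x) (suc n) k (s≤s k≤n))) (dec∘enc (x k)))

    Agree< Agree≤ : ℕ → ℕ → ℕ → ℕ → Set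
    Agree< i j m k = 1 ≤ m × (∀ n → n < i + j →
      (enc (point i n) ≤ enc (point j n) × enc (point j n) ≤ enc (point i n)) ⊎ suc (suc k) ≤ m * suc n)
    Agree≤ i j m k = ∀ n → n < i + j →
      (enc (point i n) ≤ enc (point j n) × enc (point j n) ≤ enc (point i n)) ⊎ suc k ≤ m * suc n

    enc-inj : ∀ {a b} → enc a ≤ enc b × enc b ≤ enc a → a ≡ b
    enc-inj {a} {b} (p , q) = trans (sym (dec∘enc a)) (trans (cong dec (≤-antisym p q)) (dec∘enc b))

    beyond : ∀ i j n → ¬ n < i + j → point i n ≡ point j n
    beyond i j n h = cong dec (trans (entry-zero i n (≤-trans (m≤m+n i j) (≮⇒≥ h)))
                                (sym (entry-zero j n (≤-trans (m≤n+m j i) (≮⇒≥ h)))))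

    <⇔ : ∀ i j m k → dist (point i) (point j) <ℚ (mkℚᵘ (+ m) k) ⇔ Agree< i j m k
    <⇔ i j m k = mk⇔
      (λ (u , v) → to (0<⇔ m k) u , λ n _ → case point i n ≟ᴬ point j n of λ
        { (yes e) → inj₁ (≤-reflexive (cong enc e) , ≤-reflexive (cong enc (sym e)))
        ; (no ne) → inj₂ (to (1/1+<⇔ n m k) (v n ne)) })
      (λ (u , v) → from (0<⇔ m k) u , λ n ne → case n <? i + j of λ
        { (no ge)  → contradiction (beyond i j n ge) ne
        ; (yes lt) → case v n lt of λ
          { (inj₁ e) → contradiction (enc-inj e) ne
          ; (inj₂ h) → from (1/1+<⇔ n m k) h } })

    ≤⇔ : ∀ i j m k → dist (point i) (point j) ≤ℚ (mkℚᵘ (+ m) k) ⇔ Agree≤ i j m k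
    ≤⇔ i j m k = mk⇔
      (λ ¬l n _ → case point i n ≟ᴬ point j n of λ
        { (yes e) → inj₁ (≤-reflexive (cong enc e) , ≤-reflexive (cong enc (sym e)))
        ; (no ne) → inj₂ (to (1/1+≤⇔ n m k) (ℚ.≮⇒≥ (λ h → ¬l (inj₂ (n , ne , h))))) })
      (λ v → λ
        { (inj₁ h) → ℚ.<-irrefl ℚ.≃-refl (ℚ.<-≤-trans h (0≤ m k))
        ; (inj₂ (n , ne , h)) → case n <? i + j of λ
          { (no ge)  → contradiction (beyond i j n ge) ne
          ; (yes lt) → case v n lt of λ
            { (inj₁ e) → contradiction (enc-inj e) ne
            ; (inj₂ g) → ℚ.<-irrefl ℚ.≃-refl (ℚ.<-≤-trans h (from (1/1+≤⇔ n m k) g)) } } })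

    val : ∀ {n} (a b : Fin n) → Rec (λ v → enc (point (lookup v a) (lookup v b)))
    val a b = app₁ (enc ∘ dec) rec (app₂ entry entry-rec (proj a) (proj b))

    same : ZeroSet {5} (λ v → enc (point (lookup v v₁) (lookup v v₀)) ≤ enc (point (lookup v v₂) (lookup v v₀))
                            × enc (point (lookup v v₂) (lookup v v₀)) ≤ enc (point (lookup v v₁) (lookup v v₀)))
    same = Z-× (Z-≤ (val v₁ v₀) (val v₂ v₀)) (Z-≤ (val v₂ v₀) (val v₁ v₀))

    below : ∀ {f : Vec ℕ 5 → ℕ} → Rec f → ZeroSet (λ v → f v ≤ lookup v v₃ * suc (lookup v v₀))
    below rf = Z-≤ rf (app₂ _*_ *-rec (proj v₃) (app₁ suc succ (proj v₀)))

    <-rec′ : ZeroSet {4} (λ v → Agree< (lookup v v₀) (lookup v v₁) (lookup v v₂) (lookup v v₃))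
    <-rec′ = Z-× (Z-≤ (const 1) (proj v₂))
      (Z-∀ (Z-⊎ same (below (app₁ suc succ (app₁ suc succ (proj v₄))))) (app₂ _+_ +-rec (proj v₀) (proj v₁)))

    ≤-rec′ : ZeroSet {4} (λ v → Agree≤ (lookup v v₀) (lookup v v₁) (lookup v v₂) (lookup v v₃))
    ≤-rec′ = Z-∀ (Z-⊎ same (below (app₁ suc succ (proj v₄)))) (app₂ _+_ +-rec (proj v₀) (proj v₁))

  -- The distance of distinct sequences is 1/(n+1) for the least n at which
  -- they differ; the dense sequence lists the eventually dec 0 sequences.
  sequences : Space
  sequences = record
    { Carrier       = ℕ → A
    ; _≈_           = _≗_
    ; isEquivalence = record
        { refl  = λ _ → refl
        ; sym   = λ e n → sym (e n)
        ; trans = λ e e′ n → trans (e n) (e′ n) }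
    ; d             = dist
    ; d-nonneg      = λ x y q → proj₁
    ; d-zero        = zeroʳ
    ; d-sym         = λ x y q (u , v) → u , λ n ne → v n (λ e → ne (sym e))
    ; d-triangle    = triangle
    ; complete      = compl
    ; r             = point
    ; r-dense       = dense
    ; <-recursive   = toRel (Z-resp <-rec′ λ { (i ∷ j ∷ m ∷ k ∷ []) → <⇔ i j m k })
    ; ≤-recursive   = toRel (Z-resp ≤-rec′ λ { (i ∷ j ∷ m ∷ k ∷ []) → ≤⇔ i j m k })
    }

sg-rec : Recursive (λ n → 1 ∸ (1 ∸ n))
sg-rec = ext (app₂ _∸_ ∸-rec (const 1) (app₂ _∸_ ∸-rec (const 1) (proj zero)))
  (λ { (_ ∷ []) → refl })

𝒩 : Space
𝒩 = sequences _≟_ id id (λ _ → refl) (ext (proj zero) (λ { (_ ∷ []) → refl }))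

𝒞 : Space
𝒞 = sequences Bool._≟_ dec enc (λ { false → refl ; true → refl })
      (ext sg-rec (λ { (zero ∷ []) → refl ; (suc n ∷ []) → cong (1 ∸_) (sym (0∸n≡0 n)) }))
  where
  dec : ℕ → Bool
  dec zero    = false
  dec (suc _) = true
  enc : Bool → ℕ
  enc false = 0
  enc true  = 1

private
  ω-gap : ℕ → ℕ → ℝ
  ω-gap a b = gap {λ n → n ≡ 0 × a ≢ b} (λ n → (n ≟ 0) ×-dec ¬? (a ≟ b))

  ω-eq : ∀ a b → ω-gap a b <ℚ (1/1+ 0) → a ≡ b
  ω-eq a b (_ , v) with a ≟ b
  ... | yes e = e
  ... | no ne = contradiction (v 0 (refl , ne)) (ℚ.<-irrefl ℚ.≃-refl)

  ω-near : ∀ {a b} ε → 0ℚᵘ ℚ.< ε → a ≡ b → ω-gap a b <ℚ ε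
  ω-near ε h e = h , λ n (_ , ne) → contradiction e ne

  ω-triangle : ∀ a b c → ω-gap a c ≤ᴿ ω-gap a b ⊹ ω-gap b c
  ω-triangle a b c p q (u , v) (u′ , v′) = ℚ.<-trans u′ (+-pos u u′) , λ n (z , ne) →
    case a ≟ b of λ
      { (yes e) → ℚ.<-trans (v′ n (z , λ e′ → ne (trans e e′))) (+-pos u u′)
      ; (no  h) → ℚ.<-trans (v n (z , h)) (+-posʳ u u′) }

  ω-<⇔ : ∀ i j m k → ω-gap i j <ℚ (mkℚᵘ (+ m) k) ⇔
         (1 ≤ m × ((i ≤ j × j ≤ i) ⊎ suc (suc k) ≤ m * 1))
  ω-<⇔ i j m k = mk⇔
    (λ (u , v) → to (0<⇔ m k) u , (case i ≟ j of λ
      { (yes e) → inj₁ (≤-reflexive e , ≤-reflexive (sym e))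
      ; (no ne) → inj₂ (to (1/1+<⇔ 0 m k) (v 0 (refl , ne))) }))
    (λ { (u , inj₁ (a , b)) → from (0<⇔ m k) u , λ n (_ , ne) → contradiction (≤-antisym a b) ne
       ; (u , inj₂ h)       → from (0<⇔ m k) u , λ { n (refl , ne) → from (1/1+<⇔ 0 m k) h } })

  ω-≤⇔ : ∀ i j m k → ω-gap i j ≤ℚ (mkℚᵘ (+ m) k) ⇔ ((i ≤ j × j ≤ i) ⊎ suc k ≤ m * 1)
  ω-≤⇔ i j m k = mk⇔
    (λ ¬l → case i ≟ j of λ
      { (yes e) → inj₁ (≤-reflexive e , ≤-reflexive (sym e))
      ; (no ne) → inj₂ (to (1/1+≤⇔ 0 m k) (ℚ.≮⇒≥ (λ h → ¬l (inj₂ (0 , (refl , ne) , h))))) })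
    (λ v → λ
      { (inj₁ h) → ℚ.<-irrefl ℚ.≃-refl (ℚ.<-≤-trans h (0≤ m k))
      ; (inj₂ (n , (refl , ne) , h)) → case v of λ
        { (inj₁ (a , b)) → ne (≤-antisym a b)
        ; (inj₂ g) → ℚ.<-irrefl ℚ.≃-refl (ℚ.<-≤-trans h (from (1/1+≤⇔ 0 m k) g)) } })

  ω-same : ZeroSet {4} (λ v → lookup v v₀ ≤ lookup v v₁ × lookup v v₁ ≤ lookup v v₀)
  ω-same = Z-× (Z-≤ (proj v₀) (proj v₁)) (Z-≤ (proj v₁) (proj v₀))

  ω-below : ∀ {f : Vec ℕ 4 → ℕ} → Rec f → ZeroSet (λ v → f v ≤ lookup v v₂ * 1)
  ω-below rf = Z-≤ rf (app₂ _*_ *-rec (proj v₂) (const 1))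

-- Distinct points have distance 1.
ω : Space
ω = record
  { Carrier       = ℕ
  ; _≈_           = _≡_
  ; isEquivalence = ≡-isEquivalence
  ; d             = ω-gap
  ; d-nonneg      = λ a b q → proj₁
  ; d-zero        = λ a b → mk⇔ (λ (h , _) → ω-eq a b (h (1/1+ 0) (1/1+-pos 0)))
                                (λ e → (λ q h → ω-near q h e) , λ q → proj₁)
  ; d-sym         = λ a b q (u , v) → u , λ n (z , ne) → v n (z , λ e → ne (sym e))
  ; d-triangle    = ω-triangle
  ; complete      = λ s c → let K , h = c (1/1+ 0) (1/1+-pos 0) in
      s K , λ ε ε>0 → K , λ n K≤n → ω-near ε ε>0 (ω-eq (s n) (s K) (h n K K≤n ≤-refl))
  ; r             = id
  ; r-dense       = λ x ε h → x , ω-near ε h refl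
  ; <-recursive   = toRel (Z-resp
      (Z-× (Z-≤ (const 1) (proj v₂)) (Z-⊎ ω-same (ω-below (app₁ suc succ (app₁ suc succ (proj v₃))))))
      λ { (i ∷ j ∷ m ∷ k ∷ []) → ω-<⇔ i j m k })
  ; ≤-recursive   = toRel (Z-resp
      (Z-⊎ ω-same (ω-below (app₁ suc succ (proj v₃))))
      λ { (i ∷ j ∷ m ∷ k ∷ []) → ω-≤⇔ i j m k })
  }

private
  args : (ℕ → ℕ) → Fin 4 → Vec ℕ 4 → ℕ
  args π zero                   v = π (lookup v v₀)
  args π (suc zero)             v = π (lookup v v₁)
  args π (suc (suc zero))       v = lookup v v₂
  args π (suc (suc (suc zero))) v = lookup v v₃

  args-rec : ∀ {π} → Recursive π → ∀ i → Rec (args π i)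
  args-rec {π} rπ zero                   = app₁ π rπ (proj v₀)
  args-rec {π} rπ (suc zero)             = app₁ π rπ (proj v₁)
  args-rec rπ (suc (suc zero))       = proj v₂
  args-rec rπ (suc (suc (suc zero))) = proj v₃

  product-rel : ∀ {R R′ : ℕ → ℕ → ℕ → ℕ → Set} →
    RecursiveRel (uncurry₄ R) → RecursiveRel (uncurry₄ R′) →
    ZeroSet (uncurry₄ λ i j m k → R (π₁ i) (π₁ j) m k × R′ (π₂ i) (π₂ j) m k)
  product-rel {R} {R′} rR rR′ = Z-resp
    (Z-× (Z-subst (args π₁) (fromRel rR) (args-rec π₁-rec))
         (Z-subst (args π₂) (fromRel rR′) (args-rec π₂-rec)))
    λ { (i ∷ j ∷ m ∷ k ∷ []) → mk⇔ id id }

infixr 2 _×ˢ_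

-- The maximum metric, so that a ball is a product of balls of equal radius.
_×ˢ_ : Space → Space → Space
X ×ˢ Y = record
  { Carrier       = X.Carrier × Y.Carrier
  ; _≈_           = Pointwise X._≈_ Y._≈_
  ; isEquivalence = ×-isEquivalence X.isEquivalence Y.isEquivalence
  ; d             = λ (x , y) (x′ , y′) → X.d x x′ ⊔ᴿ Y.d y y′
  ; d-nonneg      = λ (x , y) (x′ , y′) q (u , _) → X.d-nonneg x x′ q u
  ; d-zero        = λ (x , y) (x′ , y′) → mk⇔
      (λ (h , _) → to (X.d-zero x x′) ((λ q u → proj₁ (h q u)) , X.d-nonneg x x′)
                 , to (Y.d-zero y y′) ((λ q u → proj₂ (h q u)) , Y.d-nonneg y y′))
      (λ (e , e′) → (λ q u → proj₁ (from (X.d-zero x x′) e) q u , proj₁ (from (Y.d-zero y y′) e′) q u)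
                  , λ q (u , _) → X.d-nonneg x x′ q u)
  ; d-sym         = λ (x , y) (x′ , y′) q (u , v) → X.d-sym x x′ q u , Y.d-sym y y′ q v
  ; d-triangle    = λ (x , y) (x′ , y′) (x″ , y″) p q (u , v) (u′ , v′) →
      X.d-triangle x x′ x″ p q u u′ , Y.d-triangle y y′ y″ p q v v′
  ; complete      = λ s c →
      let x , cx = X.complete (proj₁ ∘ s) (λ ε h → let K , k = c ε h in K , λ m n a b → proj₁ (k m n a b))
          y , cy = Y.complete (proj₂ ∘ s) (λ ε h → let K , k = c ε h in K , λ m n a b → proj₂ (k m n a b))
      in (x , y) , λ ε h →
        let K , k = cx ε h
            L , l = cy ε h
        in K ⊔ L , λ n a → k n (≤-trans (m≤m⊔n K L) a) , l n (≤-trans (m≤n⊔m K L) a)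
  ; r             = λ i → X.r (π₁ i) , Y.r (π₂ i)
  ; r-dense       = λ (x , y) ε h →
      let i , a = X.r-dense x ε h
          j , b = Y.r-dense y ε h
      in pair i j , subst (λ z → X.d x (X.r z) <ℚ ε) (sym (π₁-pair i j)) a
                  , subst (λ z → Y.d y (Y.r z) <ℚ ε) (sym (π₂-pair i j)) b
  ; <-recursive   = toRel (Z-resp (product-rel X.<-recursive Y.<-recursive)
      λ { (i ∷ j ∷ m ∷ k ∷ []) → mk⇔ id id })
  ; ≤-recursive   = toRel (Z-resp (product-rel X.≤-recursive Y.≤-recursive)
      λ { (i ∷ j ∷ m ∷ k ∷ []) → mk⇔
        (λ h → (λ l → h (inj₁ l)) , (λ l → h (inj₂ l)))
        (λ (f , g) → λ { (inj₁ l) → f l ; (inj₂ l) → g l }) })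
  }
  where
  module X = Space X
  module Y = Space Y

data Type≤1 : Space → Set₁ where
  ω-type   : Type≤1 ω
  𝒩-type   : Type≤1 𝒩
  𝒞-type   : Type≤1 𝒞
  _×-type_ : ∀ {X Y} → Type≤1 X → Type≤1 Y → Type≤1 (X ×ˢ Y)

Baire : Set
Baire = ℕ → ℕ

Σ⁰₁ : (X : Space) → Pred (Carrier X) 0ℓ → Set
Σ⁰₁ X B = ∃[ ε ] Recursive ε × B ≐ (λ x → ∃[ i ] x ∈ N X (ε i))

RecursiveMap : (X Y : Space) → (Carrier X → Carrier Y) → Set
RecursiveMap X Y f = Σ⁰₁ (X ×ˢ ω) (λ (x , k) → f x ∈ N Y k)

record GoodParametrization : Set₁ where
  field
    G          : ∀ X → Pred (Baire × Carrier X) 0ℓ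
    G-Σ⁰₁      : ∀ X → Σ⁰₁ (𝒩 ×ˢ X) (G X)
    open⇔      : ∀ X P → Open X P ⇔ (∃[ γ ] P ≐ (λ x → (γ , x) ∈ G X))
    Σ⁰₁⇔       : ∀ X P → Σ⁰₁ X P ⇔ (∃[ γ ] Recursive γ × P ≐ (λ x → (γ , x) ∈ G X))
    S          : ∀ {X} → Type≤1 X → ∀ Y → Baire × Carrier X → Baire
    S-recursive : ∀ {X} (t : Type≤1 X) Y → RecursiveMap (𝒩 ×ˢ X) 𝒩 (S t Y)
    S-spec     : ∀ {X} (t : Type≤1 X) Y γ x y →
                 (γ , x , y) ∈ G (X ×ˢ Y) ⇔ (S t Y (γ , x) , y) ∈ G Y

-- Notations for the countable ordinals: sup f is the supremum of an arbitrary
-- sequence.  Different terms may denote the same ordinal; equality is _≈ₒ_.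
data ω₁ : Set where
  0ₒ   : ω₁
  sucₒ : ω₁ → ω₁
  sup  : (ℕ → ω₁) → ω₁

infix 4 _≤ₒ_ _<ₒ_ _≈ₒ_

data _≤ₒ_ : ω₁ → ω₁ → Set where
  0≤ₒ     : ∀ {α} → 0ₒ ≤ₒ α
  suc≤suc : ∀ {α β} → α ≤ₒ β → sucₒ α ≤ₒ sucₒ β
  ≤sup    : ∀ {α f} n → α ≤ₒ f n → α ≤ₒ sup f
  sup≤    : ∀ {f α} → (∀ n → f n ≤ₒ α) → sup f ≤ₒ α

_<ₒ_ _≈ₒ_ : ω₁ → ω₁ → Set
α <ₒ β = sucₒ α ≤ₒ β
α ≈ₒ β = α ≤ₒ β × β ≤ₒ α

1ₒ 2ₒ : ω₁
1ₒ = sucₒ 0ₒ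
2ₒ = sucₒ 1ₒ

infix 30 _⟨_⟩ _⋆

_⟨_⟩ : Baire → ℕ → Baire
(γ ⟨ i ⟩) j = γ (pair i j)

_⋆ : Baire → Baire
(γ ⋆) i = γ (i + 1)

module _ (𝔾 : GoodParametrization) where

  open GoodParametrization 𝔾

  -- {γ}(x) is defined and equal to y.  By N-separates below there is at
  -- most one such y, up to _≈_.
  Value : (X Y : Space) → Baire → Carrier X → Carrier Y → Set
  Value X Y γ x y = ∀ k → y ∈ N Y k ⇔ (γ , x , k) ∈ G (X ×ˢ ω)

  -- BC ξ is empty for ξ = 0.  In the second clause δ i is the value {γ⋆}(i)
  -- and η i witnesses that it belongs to the union of the BC η, 1 ≤ η < ξ.
  data BC : ω₁ → Pred Baire 0ℓ where
    base : ∀ {ξ γ} → ξ ≈ₒ 1ₒ → γ 0 ≡ 0 → BC ξ γ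
    step : ∀ {ξ γ} → 2ₒ ≤ₒ ξ → γ 0 ≡ 1 →
           (δ : ℕ → Baire) → (∀ i → Value ω 𝒩 (γ ⋆) i (δ i)) →
           (η : ℕ → ω₁) → (∀ i → 1ₒ ≤ₒ η i × η i <ₒ ξ) →
           (∀ i → δ i ∈ BC (η i)) → BC ξ γ

  -- The set coded by γ does not depend on the derivation of γ ∈ BC ξ, nor
  -- on ξ; see ρ-unique.
  ρ : ∀ X {ξ γ} → γ ∈ BC ξ → Pred (Carrier X) 0ℓ
  ρ X {γ = γ} (base _ _)         x = ∃[ i ] x ∈ N X ((γ ⋆) i)
  ρ X         (step _ _ _ _ _ _ c) x = ∃[ i ] x ∉ ρ X (c i)

private
  upper-≤ : ∀ (z : ℝ) {p q} → p ℚ.≤ q → z <ℚ p → z <ℚ q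
  upper-≤ z {p} {q} p≤q u = let r , a , b = to (upper-rounded z p) u in
    from (upper-rounded z q) (r , ℚ.<-≤-trans a p≤q , b)

  half : ∀ ε → 0ℚᵘ ℚ.< ε → ∃[ n ] (1/1+ n) ℚ.+ (1/1+ n) ℚ.≤ ε
  half ε h =
    let n , a = archimedean (ℚ.positive⁻¹ (ε ℚ.* ℚ.½) {{ℚ.pos*pos⇒pos ε {{ℚ.positive h}} ℚ.½}})
    in n , ℚ.≤-respʳ-≃ twice (ℚ.<⇒≤ (ℚ.+-mono-< a a))
    where
    twice : ε ℚ.* ℚ.½ ℚ.+ ε ℚ.* ℚ.½ ℚ.≃ ε
    twice = ℚ.≃-trans (ℚ.≃-sym (ℚ.*-distribˡ-+ ε ℚ.½ ℚ.½))
      (ℚ.≃-trans (ℚ.*-congˡ {ε} {ℚ.½ ℚ.+ ℚ.½} {ℚ.1ℚᵘ} (ℚ.*≡* refl)) (ℚ.*-identityʳ ε))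

N-ball : ∀ X i m n x → x ∈ N X (pair i (pair m n)) ⇔ Space.d X (Space.r X i) x <ℚ (+ m ℚ./ suc n)
N-ball X i m n x = mk⇔
  (subst id (ball≡ (π₁-pair i (pair m n)) snd₁ snd₂))
  (subst id (sym (ball≡ (π₁-pair i (pair m n)) snd₁ snd₂)))
  where
  snd₁ : π₁ (π₂ (pair i (pair m n))) ≡ m
  snd₁ = trans (cong π₁ (π₂-pair i (pair m n))) (π₁-pair m n)
  snd₂ : π₂ (π₂ (pair i (pair m n))) ≡ n
  snd₂ = trans (cong π₂ (π₂-pair i (pair m n))) (π₂-pair m n)
  ball≡ : ∀ {i i′ m m′ n n′} → i ≡ i′ → m ≡ m′ → n ≡ n′ →
          (Space.d X (Space.r X i) x <ℚ (+ m ℚ./ suc n)) ≡ (Space.d X (Space.r X i′) x <ℚ (+ m′ ℚ./ suc n′))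
  ball≡ refl refl refl = refl

N-separates : ∀ X {x y} → (∀ k → x ∈ N X k ⇔ y ∈ N X k) → Space._≈_ X x y
N-separates X {x} {y} e = to (d-zero x y) (small , d-nonneg x y)
  where
  open Space X
  small : d x y ≤ᴿ 0ᴿ
  small ε h with half ε h
  ... | n , a with r-dense x (1/1+ n) (1/1+-pos n)
  ...   | i , u = upper-≤ (d x y) a (d-triangle x (r i) y _ _ u (to (N-ball X i 1 n y)
                    (to (e (pair i (pair 1 n))) (from (N-ball X i 1 n x) (d-sym (r i) x _ u)))))

N-resp : ∀ X k {x y} → Space._≈_ X x y → x ∈ N X k → y ∈ N X k
N-resp X k {x} {y} e u =
  let p , a , b = to (upper-rounded (d c x) q) u
      0<q-p = ℚ.<-respˡ-≃ (ℚ.+-inverseʳ p) (ℚ.+-monoˡ-< (ℚ.- p) a)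
  in upper-≤ (d c y) (ℚ.≤-reflexive (cancel p))
       (d-triangle c x y p (q ℚ.- p) b (proj₁ (from (d-zero x y) e) (q ℚ.- p) 0<q-p))
  where
  open Space X
  c = r (π₁ k)
  q = + π₁ (π₂ k) ℚ./ suc (π₂ (π₂ k))
  cancel : ∀ p → p ℚ.+ (q ℚ.- p) ℚ.≃ q
  cancel p = ℚ.≃-trans (ℚ.+-comm p (q ℚ.- p)) (ℚ.≃-trans (ℚ.+-assoc q (ℚ.- p) p)
    (ℚ.≃-trans (ℚ.+-congʳ q (ℚ.+-inverseˡ p)) (ℚ.+-identityʳ q)))

Σ⁰₁-resp : ∀ X {B} → Σ⁰₁ X B → ∀ {x y} → Space._≈_ X x y → x ∈ B → y ∈ B
Σ⁰₁-resp X (ε , _ , B⊆ , ⊆B) e b = let i , n = B⊆ b in ⊆B (i , N-resp X (ε i) e n)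

module _ (𝔾 : GoodParametrization) where

  open GoodParametrization 𝔾

  Value-unique : ∀ X Y {γ γ′ x y y′} → γ ≗ γ′ →
                 Value 𝔾 X Y γ x y → Value 𝔾 X Y γ′ x y′ → Space._≈_ Y y y′
  Value-unique X Y {γ} {γ′} {x} e v v′ = N-separates Y λ k → mk⇔
    (λ h → from (v′ k) (Σ⁰₁-resp (𝒩 ×ˢ X ×ˢ ω) (G-Σ⁰₁ (X ×ˢ ω)) {γ , x , k} {γ′ , x , k} (e , X-refl , refl) (to (v k) h)))
    (λ h → from (v k) (Σ⁰₁-resp (𝒩 ×ˢ X ×ˢ ω) (G-Σ⁰₁ (X ×ˢ ω)) {γ′ , x , k} {γ , x , k} ((λ n → sym (e n)) , X-refl , refl) (to (v′ k) h)))
    where X-refl = IsEquivalence.refl (Space.isEquivalence X)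

  ρ-unique : ∀ X {ξ η γ δ} → γ ≗ δ → (p : γ ∈ BC 𝔾 ξ) (q : δ ∈ BC 𝔾 η) → ρ 𝔾 X p ≐ ρ 𝔾 X q
  ρ-unique X e (base _ _) (base _ _) =
    (λ (i , h) → i , subst (λ k → N X k _) (e (i + 1)) h) ,
    (λ (i , h) → i , subst (λ k → N X k _) (sym (e (i + 1))) h)
  ρ-unique X e (base _ z) (step _ z′ _ _ _ _ _) with () ← trans (sym z) (trans (e 0) z′)
  ρ-unique X e (step _ z′ _ _ _ _ _) (base _ z) with () ← trans (sym z) (trans (sym (e 0)) z′)
  ρ-unique X e (step _ _ _ v _ _ c) (step _ _ _ v′ _ _ c′) =
    (λ (i , h) → i , λ h′ → h (proj₂ (same i) h′)) ,
    (λ (i , h) → i , λ h′ → h (proj₁ (same i) h′))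
    where
    same : ∀ i → ρ 𝔾 X (c i) ≐ ρ 𝔾 X (c′ i)
    same i = ρ-unique X (Value-unique ω 𝒩 (λ n → e (n + 1)) (v i) (v′ i)) (c i) (c′ i)

-- (b): when γ(0) = 1, the map (γ, k) ↦ {((γ)_{k₀})*}(k₁), with k = 2^{k₀}(2k₁ + 1) - 1,
-- is recursive and partial; S turns an index of it into a code of the union.
--
-- (a): the projection of ⋃ⱼ ¬Aⱼ along ω is ⋃ₘⱼ ¬(Aⱼ)ₘ, so codes of the sections at
-- each m are needed, and the section at m of ⋃ⱼ ¬Aⱼ is ⋃ⱼ ¬(Aⱼ)ₘ.  Code maps for
-- the projection and for all sections are obtained together, as one recursive map
-- W(e, γ, n) whose defining equation {W(e, γ, n)*}(i) = W(e, {γ*}(j), n′) holds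
-- when e is an index of its right-hand side.  At level 1 a basic neighbourhood of
-- ω × X is a product of two balls, whose projection and sections are basic
-- neighbourhoods of X (or empty), given by functions of its index independent of X.
--
-- Recursiveness is checked on finite products of ω and 𝒩.  These are ultrametric,
-- which makes inclusion of small balls in a basic neighbourhood decidable on
-- indices, hence Σ⁰₁ closed under finite intersections and bounded quantifiers.

module Submission where

open import Defs
open import Level using (0ℓ)
open import Data.Empty using (⊥-elim)
open import Data.Fin.Base using (Fin; zero; suc)
open import Data.Fin.Patterns using (0F; 1F; 2F)
open import Data.Integer.Base as ℤ using (+_)
import Data.Integer.Properties as ℤ
open import Data.Nat.Base
open import Data.Nat.Properties
open import Data.Product.Base using (_×_; _,_; Σ-syntax; ∃-syntax; proj₁; proj₂)
open import Data.Rational.Unnormalised.Base as ℚ using (ℚᵘ; mkℚᵘ; 0ℚᵘ; *<*; *≤*)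
import Data.Rational.Unnormalised.Properties as ℚ
open import Data.Vec.Base using (Vec; []; _∷_; head; tail; lookup)
open import Data.Vec.Properties using (tabulate∘lookup)
open import Data.Sum.Base using (inj₁; inj₂)
open import Function.Base using (_∘_; id)
open import Function.Bundles using (_⇔_; mk⇔; Equivalence)
open import Function.Construct.Composition using (_⇔-∘_)
open import Function.Construct.Symmetry using (⇔-sym)
open import Relation.Binary.Structures using (IsEquivalence)
open import Relation.Binary.PropositionalEquality hiding (isEquivalence)
open import Relation.Nullary using (¬_; yes; no; contradiction)
open import Relation.Unary using (Pred; _∈_; _∉_)

open Equivalence using (to; from)
open Space using (Carrier)

private variable
  m n : ℕ

-- Recursive functions

record Recs (g : Vec ℕ n → Vec ℕ m) : Set where
  constructor recs
  field components : ∀ i → Rec (λ v → lookup (g v) i)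

infixr 9 _∘ʳ_
infixr 5 _∷ʳ_

_∘ʳ_ : ∀ {f : Vec ℕ m → ℕ} {g : Vec ℕ n → Vec ℕ m} → Rec f → Recs g → Rec (f ∘ g)
_∘ʳ_ {f = f} {g} rf (recs rg) = comp rf rg (λ v → cong f (sym (tabulate∘lookup (g v))))

[]ʳ : Recs {n} (λ _ → [])
[]ʳ = recs λ ()

_∷ʳ_ : ∀ {f : Vec ℕ n → ℕ} {g : Vec ℕ n → Vec ℕ m} → Rec f → Recs g → Recs (λ v → f v ∷ g v)
rf ∷ʳ recs rg = recs λ { zero → rf ; (suc i) → rg i }

idʳ : Recs {n} id
idʳ = recs proj

headʳ : Rec {suc n} head
headʳ = ext (proj zero) (λ { (_ ∷ _) → refl })

tailʳ : Recs {suc n} tail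
tailʳ = recs λ i → ext (proj (suc i)) (λ { (_ ∷ _) → refl })

infixr 9 _∘ʳˢ_

_∘ʳˢ_ : ∀ {l} {f : Vec ℕ m → Vec ℕ l} {g : Vec ℕ n → Vec ℕ m} → Recs f → Recs g → Recs (f ∘ g)
recs rf ∘ʳˢ rg = recs λ i → rf i ∘ʳ rg

pair-rec : Recursive₂ pair
pair-rec = app₂ _∸_ ∸-rec (app₂ _*_ *-rec (pow (proj 0F))
  (app₂ _+_ +-rec (app₂ _*_ *-rec (const 2) (proj 1F)) (const 1))) (const 1)
  where
  pow : ∀ {f : Vec ℕ n → ℕ} → Rec f → Rec (λ v → 2 ^ f v)
  pow = app₁ (2 ^_) (prim (const 1) (app₂ _*_ *-rec (const 2) (proj 1F))
    (λ { [] → refl }) (λ { _ [] → refl }))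

-- Since `N X 0` is empty, `guard c k` as an index imposes the decidable condition `c ≡ 0` on
-- `N X k`.
guard unless : ℕ → ℕ → ℕ
guard zero    k = k
guard (suc _) k = 0
unless zero    k = 0
unless (suc _) k = k

guard-rec : Recursive₂ guard
guard-rec = prim (proj 0F) (const 0) (λ { (_ ∷ []) → refl }) (λ { _ (_ ∷ []) → refl })

unless-rec : Recursive₂ unless
unless-rec = prim (const 0) (proj 2F) (λ { (_ ∷ []) → refl }) (λ { _ (_ ∷ []) → refl })

select : ℕ → ℕ → ℕ → ℕ
select zero    a b = a
select (suc _) a b = b

select-+ : ∀ c a b → select c a b ≡ guard c a + unless c b
select-+ zero    a b = sym (+-identityʳ a)
select-+ (suc _) a b = refl

select-rec : ∀ {f g h : Vec ℕ n → ℕ} → Rec f → Rec g → Rec h →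
             Rec (λ v → select (f v) (g v) (h v))
select-rec {f = f} {g} {h} rf rg rh = ext
  (app₂ _+_ +-rec (app₂ guard guard-rec rf rg) (app₂ unless unless-rec rf rh))
  (λ v → select-+ (f v) (g v) (h v))

Z-∘ : ∀ {R : Pred (Vec ℕ m) 0ℓ} {g : Vec ℕ n → Vec ℕ m} → ZeroSet R → Recs g → ZeroSet (R ∘ g)
Z-∘ {g = g} (zeroSet r e) rg = zeroSet (r ∘ʳ rg) (λ v → e (g v))

Z-≡ : ∀ {f g : Vec ℕ n → ℕ} → Rec f → Rec g → ZeroSet (λ v → f v ≡ g v)
Z-≡ rf rg = Z-resp (Z-× (Z-≤ rf rg) (Z-≤ rg rf))
  (λ _ → mk⇔ (λ e → ≤-reflexive e , ≤-reflexive (sym e)) (λ (p , q) → ≤-antisym p q))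

-- Neighbourhoods

radius : ℕ → ℚᵘ
radius k = + π₁ k ℚ./ suc (π₂ k)

<ℚ-≤ : ∀ (z : ℝ) {p q} → p ℚ.≤ q → z <ℚ p → z <ℚ q
<ℚ-≤ z {p} {q} p≤q u = let r , a , b = to (ℝ.upper-rounded z p) u in
  from (ℝ.upper-rounded z q) (r , ℚ.<-≤-trans a p≤q , b)

N-pair : ∀ X i q x → x ∈ N X (pair i q) ⇔ Space.d X (Space.r X i) x <ℚ radius q
N-pair X i q x = mk⇔
  (subst₂ (λ a b → Space.d X (Space.r X a) x <ℚ radius b) (π₁-pair i q) (π₂-pair i q))
  (subst₂ (λ a b → Space.d X (Space.r X a) x <ℚ radius b) (sym (π₁-pair i q)) (sym (π₂-pair i q)))

radius-pos : ∀ X k {x} → x ∈ N X k → 0ℚᵘ ℚ.< radius (π₂ k)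
radius-pos X k {x} = Space.d-nonneg X _ x _

N-0-empty : ∀ X {x} → x ∉ N X 0
N-0-empty X h = ℚ.<-irrefl (ℚ.*≡* refl) (radius-pos X 0 h)

N-guard : ∀ X c k x → x ∈ N X (guard c k) ⇔ (c ≡ 0 × x ∈ N X k)
N-guard X zero    k x = mk⇔ (refl ,_) proj₂
N-guard X (suc c) k x = mk⇔ (⊥-elim ∘ N-0-empty X) (λ ())

1/1+-< : ∀ {m n} → m < n → 1/1+ n ℚ.< 1/1+ m
1/1+-< m<n = *<* (ℤ.+<+ (s≤s (+-monoˡ-< 0 m<n)))

1/1+≤ : ∀ m n {s} → 0ℚᵘ ℚ.< mkℚᵘ (+ m) n → n ≤ s → 1/1+ s ℚ.≤ mkℚᵘ (+ m) n
1/1+≤ zero    n (*<* (ℤ.+<+ ()))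
1/1+≤ (suc m) n _ n≤s = ℚ.≤-trans (1/1+-anti n≤s)
  (*≤* (ℤ.*-monoʳ-≤-nonNeg (+ suc n) {+ 1} {+ suc m} (ℤ.+≤+ (s≤s z≤n))))

nearby : ∀ X x ε → 0ℚᵘ ℚ.< ε → ∃[ i ] Space.d X (Space.r X i) x <ℚ ε
nearby X x ε h = let i , u = Space.r-dense X x ε h in i , Space.d-sym X _ x ε u

fstᴺ sndᴺ : ℕ → ℕ
fstᴺ k = pair (π₁ (π₁ k)) (π₂ k)
sndᴺ k = pair (π₂ (π₁ k)) (π₂ k)

N-× : ∀ X Y k x y → (x , y) ∈ N (X ×ˢ Y) k ⇔ (x ∈ N X (fstᴺ k) × y ∈ N Y (sndᴺ k))
N-× X Y k x y = mk⇔
  (λ (a , b) → from (N-pair X (π₁ (π₁ k)) (π₂ k) x) a , from (N-pair Y (π₂ (π₁ k)) (π₂ k) y) b)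
  (λ (a , b) → to (N-pair X (π₁ (π₁ k)) (π₂ k) x) a , to (N-pair Y (π₂ (π₁ k)) (π₂ k) y) b)

fstᴺ-rec : Recursive fstᴺ
fstᴺ-rec = ext (app₂ pair pair-rec (app₁ π₁ π₁-rec (app₁ π₁ π₁-rec headʳ)) (app₁ π₂ π₂-rec headʳ)) (λ _ → refl)

sndᴺ-rec : Recursive sndᴺ
sndᴺ-rec = ext (app₂ pair pair-rec (app₁ π₂ π₂-rec (app₁ π₁ π₁-rec headʳ)) (app₁ π₂ π₂-rec headʳ)) (λ _ → refl)

-- Finite products of ω and 𝒩, as codes: Agda then never has to unify two
-- records of metric data.

infixr 2 _×ᵘ_

data Shape : Set where
  ωᵘ 𝒩ᵘ : Shape
  _×ᵘ_  : Shape → Shape → Shape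

space : Shape → Space
space ωᵘ       = ω
space 𝒩ᵘ       = 𝒩
space (X ×ᵘ Y) = space X ×ˢ space Y

type≤1 : ∀ X → Type≤1 (space X)
type≤1 ωᵘ       = ω-type
type≤1 𝒩ᵘ       = 𝒩-type
type≤1 (X ×ᵘ Y) = type≤1 X ×-type type≤1 Y

≢-split : ∀ {A : Set} (a b : ℕ) {c} → (a ≢ b → A) → (b ≢ c → A) → a ≢ c → A
≢-split a b f g ne with a ≟ b
... | yes refl = g ne
... | no  a≢b  = f a≢b

-- Where `x` and `z` differ, `y` differs from one of them; the maximum metric inherits the
-- inequality.
ultra : ∀ X x y z q → let open Space (space X) in d x y <ℚ q → d y z <ℚ q → d x z <ℚ q
ultra ωᵘ a b c q (u , v) (_ , v′) =
  u , λ n (z , ne) → ≢-split a b (v n ∘ (z ,_)) (v′ n ∘ (z ,_)) ne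
ultra 𝒩ᵘ x y z q (u , v) (_ , v′) = u , λ n → ≢-split (x n) (y n) (v n) (v′ n)
ultra (X ×ᵘ Y) (x , x′) (y , y′) (z , z′) q (u , v) (u′ , v′) =
  ultra X x y z q u u′ , ultra Y x′ y′ z′ q v v′

-- Ball κ is the ball of radius 1/(κ₁ + 1) about r κ₀.  By ultrametricity it is
-- contained in N k once its radius is small enough and its centre is in N k.
module Balls (X : Shape) where

  open Space (space X) hiding (Carrier)

  Ball : ℕ → Pred (Carrier (space X)) 0ℓ
  Ball κ x = d (r (π₁ κ)) x <ℚ (1/1+ π₂ κ)

  Inside : ℕ → ℕ → Set
  Inside κ k = r (π₁ κ) ∈ N (space X) k × π₂ (π₂ k) ≤ π₂ κ

  inside-sound : ∀ κ k {x} → Inside κ k → x ∈ Ball κ → x ∈ N (space X) k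
  inside-sound κ k {x} (c , n≤s) h =
    ultra X _ (r (π₁ κ)) x _ c (<ℚ-≤ (d _ x) (1/1+≤ (π₁ (π₂ k)) (π₂ (π₂ k)) (radius-pos (space X) k c) n≤s) h)

  -- The centre is a dense point within 1/(s+1) of `x`. Each `N k` around `x` whose denominator is
  -- at most s + 1 has at least that radius, so by ultrametricity it contains the centre too.
  refine : ∀ x s → ∃[ κ ] x ∈ Ball κ × (∀ k → x ∈ N (space X) k → π₂ (π₂ k) ≤ s → Inside κ k)
  refine x s with nearby (space X) x (1/1+ s) (1/1+-pos s)
  ... | i , h = pair i s , h′ , λ k a n≤s → let n≤s′ = subst (_ ≤_) (sym (π₂-pair i s)) n≤s in
      ultra X _ x _ _ a (d-sym x _ _ (<ℚ-≤ (d _ x) (1/1+≤ (π₁ (π₂ k)) (π₂ (π₂ k)) (radius-pos (space X) k a) n≤s′) h′)) , n≤s′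
    where
    h′ : x ∈ Ball (pair i s)
    h′ = subst₂ (λ a b → d (r a) x <ℚ (1/1+ b)) (sym (π₁-pair i s)) (sym (π₂-pair i s)) h

  ballᴺ : ℕ → ℕ
  ballᴺ κ = pair (π₁ κ) (pair 1 (π₂ κ))

  N-ballᴺ : ∀ κ x → x ∈ N (space X) (ballᴺ κ) ⇔ x ∈ Ball κ
  N-ballᴺ κ x = N-ball (space X) (π₁ κ) 1 (π₂ κ) x

  centre-rec : ZeroSet {2} (λ v → r (head v) ∈ N (space X) (head (tail v)))
  centre-rec = Z-∘ (fromRel <-recursive)
    (app₁ π₁ π₁-rec k ∷ʳ headʳ ∷ʳ app₁ π₁ π₁-rec (app₁ π₂ π₂-rec k) ∷ʳ app₁ π₂ π₂-rec (app₁ π₂ π₂-rec k) ∷ʳ []ʳ)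
    where k = headʳ ∘ʳ tailʳ

  inside-rec : ZeroSet {2} (λ v → Inside (head v) (head (tail v)))
  inside-rec = Z-×
    (Z-∘ centre-rec (app₁ π₁ π₁-rec headʳ ∷ʳ headʳ ∘ʳ tailʳ ∷ʳ []ʳ))
    (Z-≤ (app₁ π₂ π₂-rec (app₁ π₂ π₂-rec (headʳ ∘ʳ tailʳ))) (app₁ π₂ π₂-rec headʳ))

𝒩-ball : ∀ x y s → Space.d 𝒩 x y <ℚ (1/1+ s) ⇔ (∀ k → k ≤ s → x k ≡ y k)
𝒩-ball x y s = mk⇔
  (λ (_ , v) k k≤s → agree (x k) (y k) λ ne → ℚ.<-irrefl ℚ.≃-refl (ℚ.<-≤-trans (v k ne) (1/1+-anti k≤s)))
  (λ e → 1/1+-pos s , λ k ne → 1/1+-< (≰⇒> λ k≤s → ne (e k k≤s)))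
  where
  agree : ∀ a b → ¬ (a ≢ b) → a ≡ b
  agree a b h with a ≟ b
  ... | yes e = e
  ... | no ne = contradiction ne h

ω-near : ∀ n q → 0ℚᵘ ℚ.< q → Space.d ω n n <ℚ q
ω-near n q h = h , λ k (_ , ne) → contradiction refl ne

-- Distinct points of `ω` have distance 1, so the open ball of radius 1/(0+1) is a singleton.
ω-ball : ∀ a b → a ≡ b ⇔ b ∈ N ω (pair a (pair 1 0))
ω-ball a b = mk⇔
  (λ { refl → from (N-ball ω a 1 0 a) (ω-near a _ (1/1+-pos 0)) })
  (λ h → same (to (N-ball ω a 1 0 b) h))
  where
  same : Space.d ω a b <ℚ (1/1+ 0) → a ≡ b
  same (_ , v) with a ≟ b
  ... | yes e = e
  ... | no ne = contradiction (v 0 (refl , ne)) (ℚ.<-irrefl ℚ.≃-refl)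

-- Semirecursive relations and recursive maps

Point : Shape → Set
Point X = Carrier (space X)

-- A `Σ⁰₁` set depending uniformly on a vector of numbers. The number parameters are kept apart from
-- `X`, so that quantifying over them and substituting recursive functions need no product with `ω`.
record Semirecursive (X : Shape) {n} (P : Point X → Vec ℕ n → Set) : Set where
  constructor semirecursive
  field
    {cover} : Vec ℕ (suc n) → ℕ
    rec     : Rec cover
    spec    : ∀ x v → P x v ⇔ (∃[ t ] x ∈ N (space X) (cover (t ∷ v)))

private variable
  X Y : Shape

SR-resp : ∀ {P Q : Point X → Vec ℕ n → Set} → Semirecursive X P → (∀ x v → Q x v ⇔ P x v) →
          Semirecursive X Q
SR-resp (semirecursive rec spec) e = semirecursive rec (λ x v → spec x v ⇔-∘ e x v)

SR-subst : ∀ {P : Point X → Vec ℕ m → Set} {g : Vec ℕ n → Vec ℕ m} → Semirecursive X P → Recs g →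
           Semirecursive X (λ x v → P x (g v))
SR-subst {g = g} (semirecursive rec spec) rg =
  semirecursive (rec ∘ʳ (headʳ ∷ʳ rg ∘ʳˢ tailʳ)) (λ x v → spec x (g v))

SR-N : ∀ {h : Vec ℕ n → ℕ} → Rec h → Semirecursive X (λ x v → x ∈ N (space X) (h v))
SR-N rh = semirecursive (rh ∘ʳ tailʳ) (λ x v → mk⇔ (0 ,_) proj₂)

SR-∃ : ∀ {P : Point X → Vec ℕ (suc n) → Set} → Semirecursive X P →
       Semirecursive X (λ x v → ∃[ k ] P x (k ∷ v))
SR-∃ {X} (semirecursive {ε} rec spec) = semirecursive
  (rec ∘ʳ (app₁ π₂ π₂-rec headʳ ∷ʳ app₁ π₁ π₁-rec headʳ ∷ʳ tailʳ))
  λ x v → mk⇔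
    (λ (k , p) → let t , h = to (spec x (k ∷ v)) p in pair k t ,
      subst₂ (λ a b → x ∈ N (space X) (ε (a ∷ b ∷ v))) (sym (π₂-pair k t)) (sym (π₁-pair k t)) h)
    (λ (t , h) → π₁ t , from (spec x (π₁ t ∷ v)) (π₂ t , h))

SR-guard : ∀ {R : Pred (Vec ℕ n) 0ℓ} {P : Point X → Vec ℕ n → Set} → ZeroSet R → Semirecursive X P →
           Semirecursive X (λ x v → R v × P x v)
SR-guard {X = X} (zeroSet {f} rf e) (semirecursive {ε} rec spec) = semirecursive
  (app₂ guard guard-rec (rf ∘ʳ tailʳ) rec)
  λ x v → mk⇔
    (λ (a , p) → let t , h = to (spec x v) p in
      t , from (N-guard (space X) (f v) (ε (t ∷ v)) x) (to (e v) a , h))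
    (λ (t , h) → let z , h′ = to (N-guard (space X) (f v) (ε (t ∷ v)) x) h in
      from (e v) z , from (spec x v) (t , h′))

N-inhabited : ∀ X x → ∃[ k ] x ∈ N X k
N-inhabited X x = let i , h = nearby X x (1/1+ 0) (1/1+-pos 0) in
  pair i (pair 1 0) , from (N-ball X i 1 0 x) h

SR-Z : ∀ {R : Pred (Vec ℕ n) 0ℓ} → ZeroSet R → Semirecursive X (λ _ v → R v)
SR-Z {X = X} z = SR-resp (SR-guard z (SR-∃ (SR-N headʳ)))
  λ x v → mk⇔ (λ a → a , N-inhabited (space X) x) proj₁

≤-∑ : ∀ f k b → k < b → f k ≤ ∑ f b
≤-∑ f k (suc b) (s≤s k≤b) with m≤n⇒m<n∨m≡n k≤b
... | inj₁ k<b  = ≤-trans (≤-∑ f k b k<b) (m≤n+m _ (f b))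
... | inj₂ refl = m≤m+n (f k) _

bounded-choice : ∀ {P : ℕ → ℕ → Set} b → (∀ j → j < b → ∃[ t ] P j t) →
                 Σ[ w ∈ (ℕ → ℕ) ] (∀ j → j < b → P j (w j))
bounded-choice zero    h = (λ _ → 0) , λ _ ()
bounded-choice {P} (suc b) h with bounded-choice {P} b (λ j j<b → h j (m<n⇒m<1+n j<b)) | h b ≤-refl
... | w , p | t , q = w′ , p′
  where
  w′ : ℕ → ℕ
  w′ j with j ≟ b
  ... | yes _ = t
  ... | no  _ = w j
  p′ : ∀ j → j < suc b → P j (w′ j)
  p′ j (s≤s j≤b) with j ≟ b
  ... | yes refl = q
  ... | no  ne   = p j (≤∧≢⇒< j≤b ne)

-- A point of finitely many neighbourhoods has a ball inside all of them.
SR-∀ : ∀ {P : Point X → Vec ℕ (suc n) → Set} {b : Vec ℕ n → ℕ} → Semirecursive X P → Rec b →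
       Semirecursive X (λ x v → ∀ j → j < b v → P x (j ∷ v))
SR-∀ {X} {n} {P} {b} (semirecursive {ε} rec spec) rb =
  SR-resp (SR-∃ (SR-∃ (SR-guard inside (SR-N ball)))) λ x v → mk⇔ (forth x v) (back x v)
  where
  open Balls X using (Inside; Ball; inside-rec; inside-sound; refine; ballᴺ; N-ballᴺ)
  nbhd : ℕ → ℕ → Vec ℕ n → ℕ
  nbhd w j v = ε (entry w j ∷ j ∷ v)

  inside : ZeroSet {2 + n} (λ u → ∀ j → j < b (tail (tail u)) →
             Inside (head u) (nbhd (head (tail u)) j (tail (tail u))))
  inside = Z-∀
    (Z-∘ inside-rec (headʳ ∘ʳ tailʳ ∷ʳ
      rec ∘ʳ (app₂ entry entry-rec (headʳ ∘ʳ tailʳ ∘ʳˢ tailʳ) headʳ ∷ʳ headʳ ∷ʳ tailʳ ∘ʳˢ tailʳ ∘ʳˢ tailʳ) ∷ʳ []ʳ))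
    (rb ∘ʳ tailʳ ∘ʳˢ tailʳ)

  ball : Rec {2 + n} (λ u → ballᴺ (head u))
  ball = app₂ pair pair-rec (app₁ π₁ π₁-rec headʳ)
    (app₂ pair pair-rec (const 1) (app₁ π₂ π₂-rec headʳ))

  forth : ∀ x v → (∀ j → j < b v → P x (j ∷ v)) →
          ∃[ w ] ∃[ κ ] (∀ j → j < b v → Inside κ (nbhd w j v)) × x ∈ N (space X) (ballᴺ κ)
  forth x v h with bounded-choice {λ j t → x ∈ N (space X) (ε (t ∷ j ∷ v))} (b v)
                     (λ j j<b → to (spec x (j ∷ v)) (h j j<b))
  -- The sum bounds the denominators of all chosen neighbourhoods at once, so that `κ` lies inside
  -- each of them.
  ... | w , p with refine x (∑ (λ j → π₂ (π₂ (nbhd (code w (b v)) j v))) (b v))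
  ...   | κ , x∈ , c = code w (b v) , κ ,
          (λ j j<b → c (nbhd (code w (b v)) j v)
            (subst (λ t → x ∈ N (space X) (ε (t ∷ j ∷ v))) (sym (entry-code w (b v) j j<b)) (p j j<b))
            (≤-∑ (λ j → π₂ (π₂ (nbhd (code w (b v)) j v))) j (b v) j<b)) ,
          from (N-ballᴺ κ x) x∈

  back : ∀ x v → (∃[ w ] ∃[ κ ] (∀ j → j < b v → Inside κ (nbhd w j v)) × x ∈ N (space X) (ballᴺ κ)) →
         ∀ j → j < b v → P x (j ∷ v)
  back x v (w , κ , c , x∈) j j<b =
    from (spec x (j ∷ v)) (entry w j , inside-sound κ (nbhd w j v) (c j j<b) (to (N-ballᴺ κ x) x∈))

-- The conjunction is a universal quantifier over `j < 2`, the two covers being merged by `select`.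
SR-× : ∀ {P Q : Point X → Vec ℕ n → Set} → Semirecursive X P → Semirecursive X Q →
       Semirecursive X (λ x v → P x v × Q x v)
SR-× {X} {n} {P} {Q} (semirecursive {ε} rec spec) (semirecursive {ε′} rec′ spec′) =
  SR-resp (SR-∀ either (const 2)) λ x v → mk⇔ (forth x v) (back x v)
  where
  E : Point X → Vec ℕ (suc n) → Set
  E x w = ∃[ t ] x ∈ N (space X) (select (head w) (ε (t ∷ tail w)) (ε′ (t ∷ tail w)))

  either : Semirecursive X E
  either = semirecursive
    (select-rec (headʳ ∘ʳ tailʳ) (rec ∘ʳ (headʳ ∷ʳ tailʳ ∘ʳˢ tailʳ)) (rec′ ∘ʳ (headʳ ∷ʳ tailʳ ∘ʳˢ tailʳ)))
    (λ x w → mk⇔ id id)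

  forth : ∀ x v → P x v × Q x v → ∀ j → j < 2 → E x (j ∷ v)
  forth x v (p , q) 0 _ = to (spec x v) p
  forth x v (p , q) 1 _ = to (spec′ x v) q
  forth x v (p , q) (suc (suc j)) (s≤s (s≤s ()))

  back : ∀ x v → (∀ j → j < 2 → E x (j ∷ v)) → P x v × Q x v
  back x v h = from (spec x v) (h 0 (s≤s z≤n)) , from (spec′ x v) (h 1 (s≤s (s≤s z≤n)))

-- For number values a semirecursive graph amounts to semirecursive preimages, see `fun→map` and
-- `map→fun`; a graph is easier to substitute into relations, as in `SR-plug`.
record RecFun (X : Shape) {n} (F : Point X → Vec ℕ n → ℕ) : Set where
  constructor recFun
  field graph : Semirecursive X (λ x w → F x (tail w) ≡ head w)

record RecMap (X : Shape) (Y : Shape) {n} (f : Point X → Vec ℕ n → Point Y) : Set where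
  constructor recMap
  field preimages : Semirecursive X (λ x w → f x (tail w) ∈ N (space Y) (head w))

open RecFun
open RecMap

fun-subst : ∀ {F : Point X → Vec ℕ m → ℕ} {g : Vec ℕ n → Vec ℕ m} → RecFun X F → Recs g →
            RecFun X (λ x v → F x (g v))
fun-subst F rg = recFun (SR-subst (graph F) (headʳ ∷ʳ rg ∘ʳˢ tailʳ))

map-subst : ∀ {S : Shape} {f : Point X → Vec ℕ m → Point S} {g : Vec ℕ n → Vec ℕ m} →
            RecMap X S f → Recs g →
            RecMap X S (λ x v → f x (g v))
map-subst f rg = recMap (SR-subst (preimages f) (headʳ ∷ʳ rg ∘ʳˢ tailʳ))

fun-rec : ∀ {g : Vec ℕ n → ℕ} → Rec g → RecFun X (λ _ → g)
fun-rec rg = recFun (SR-Z (Z-≡ (rg ∘ʳ tailʳ) headʳ))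

fun-resp : ∀ {F G : Point X → Vec ℕ n → ℕ} → RecFun X F → (∀ x v → G x v ≡ F x v) → RecFun X G
fun-resp F e = recFun (SR-resp (graph F) (λ x w → mk⇔ (trans (sym (e x _))) (trans (e x _))))

SR-plug : ∀ {P : Point X → Vec ℕ (suc n) → Set} {F : Point X → Vec ℕ n → ℕ} →
          Semirecursive X P → RecFun X F → Semirecursive X (λ x v → P x (F x v ∷ v))
SR-plug {P = P} p F = SR-resp (SR-∃ (SR-× (graph F) p)) λ x v → mk⇔
  (λ h → _ , refl , h)
  (λ (k , e , h) → subst (λ k → P x (k ∷ v)) (sym e) h)

fun-app₂ : ∀ (H : ℕ → ℕ → ℕ) {F G : Point X → Vec ℕ n → ℕ} → Recursive₂ H → RecFun X F → RecFun X G →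
           RecFun X (λ x v → H (F x v) (G x v))
fun-app₂ H {F} {G} rH rF rG = recFun (SR-resp
  (SR-plug (SR-plug (SR-Z (Z-≡ (app₂ H rH (headʳ ∘ʳ tailʳ) headʳ) (headʳ ∘ʳ tailʳ ∘ʳˢ tailʳ)))
    (fun-subst rG (tailʳ ∘ʳˢ tailʳ))) (fun-subst rF tailʳ))
  (λ x w → mk⇔ id id))

fun-select : ∀ {F G H : Point X → Vec ℕ n → ℕ} → RecFun X F → RecFun X G → RecFun X H →
             RecFun X (λ x v → select (F x v) (G x v) (H x v))
fun-select {F = F} {G} {H} rF rG rH = fun-resp
  (fun-app₂ _+_ +-rec (fun-app₂ guard guard-rec rF rG) (fun-app₂ unless unless-rec rF rH))
  (λ x v → select-+ (F x v) (G x v) (H x v))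

SR-preimage : ∀ {P : Point Y → Vec ℕ n → Set} {f : Point X → Vec ℕ n → Point Y} →
              Semirecursive Y P → RecMap X Y f → Semirecursive X (λ x v → P (f x v) v)
SR-preimage (semirecursive rec spec) f =
  SR-resp (SR-∃ (SR-subst (preimages f) (rec ∷ʳ tailʳ))) (λ x v → spec _ v)

map-∘ : ∀ {S : Shape} {g : Point Y → Vec ℕ n → Point S} {f : Point X → Vec ℕ n → Point Y} →
        RecMap Y S g → RecMap X Y f → RecMap X S (λ x v → g (f x v) v)
map-∘ g f = recMap (SR-preimage (preimages g) (map-subst f tailʳ))

map-id : RecMap X X {n} (λ x _ → x)
map-id = recMap (SR-N headʳ)

map-, : ∀ {S T : Shape} {f : Point X → Vec ℕ n → Point S} {g : Point X → Vec ℕ n → Point T} →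
        RecMap X S f → RecMap X T g → RecMap X (S ×ᵘ T) (λ x v → f x v , g x v)
map-, {S = S} {T} f g = recMap (SR-resp
  (SR-× (SR-subst (preimages f) (app₁ fstᴺ fstᴺ-rec headʳ ∷ʳ tailʳ))
        (SR-subst (preimages g) (app₁ sndᴺ sndᴺ-rec headʳ ∷ʳ tailʳ)))
  λ x w → N-× (space S) (space T) (head w) _ _)

-- Coordinates, evaluation and tabulation of recursive maps.

module _ (X Y : Space) where

  -- Balls of one positive radius about all dense points of `Y` cover `Y`, so a cylinder is a union
  -- of product balls.
  N-×-extend₁ : ∀ k x y → x ∈ N X k ⇔ (∃[ j ] (x , y) ∈ N (X ×ˢ Y) (pair (pair (π₁ k) j) (π₂ k)))
  N-×-extend₁ k x y = mk⇔
    (λ h → let j , u = nearby Y y (radius (π₂ k)) (radius-pos X k h) in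
      j , from (N-pair (X ×ˢ Y) (pair (π₁ k) j) (π₂ k) (x , y))
        ( subst (λ a → Space.d X (Space.r X a) x <ℚ radius (π₂ k)) (sym (π₁-pair (π₁ k) j)) h
        , subst (λ a → Space.d Y (Space.r Y a) y <ℚ radius (π₂ k)) (sym (π₂-pair (π₁ k) j)) u))
    (λ (j , h) → subst (λ a → Space.d X (Space.r X a) x <ℚ radius (π₂ k)) (π₁-pair (π₁ k) j)
      (proj₁ (to (N-pair (X ×ˢ Y) (pair (π₁ k) j) (π₂ k) (x , y)) h)))

  N-×-extend₂ : ∀ k x y → y ∈ N Y k ⇔ (∃[ j ] (x , y) ∈ N (X ×ˢ Y) (pair (pair j (π₁ k)) (π₂ k)))
  N-×-extend₂ k x y = mk⇔
    (λ h → let j , u = nearby X x (radius (π₂ k)) (radius-pos Y k h) in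
      j , from (N-pair (X ×ˢ Y) (pair j (π₁ k)) (π₂ k) (x , y))
        ( subst (λ a → Space.d X (Space.r X a) x <ℚ radius (π₂ k)) (sym (π₁-pair j (π₁ k))) u
        , subst (λ a → Space.d Y (Space.r Y a) y <ℚ radius (π₂ k)) (sym (π₂-pair j (π₁ k))) h))
    (λ (j , h) → subst (λ a → Space.d Y (Space.r Y a) y <ℚ radius (π₂ k)) (π₂-pair j (π₁ k))
      (proj₂ (to (N-pair (X ×ˢ Y) (pair j (π₁ k)) (π₂ k) (x , y)) h)))

map-proj₁ : RecMap (X ×ᵘ Y) X {n} (λ (x , y) _ → x)
map-proj₁ {X} {Y} {n} = recMap (SR-resp
  (SR-∃ (SR-N (app₂ pair pair-rec (app₂ pair pair-rec (app₁ π₁ π₁-rec k) headʳ) (app₁ π₂ π₂-rec k))))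
  λ (x , y) w → N-×-extend₁ (space X) (space Y) (head w) x y)
  where
  k : Rec {2 + n} (λ u → head (tail u))
  k = headʳ ∘ʳ tailʳ

map-proj₂ : RecMap (X ×ᵘ Y) Y {n} (λ (x , y) _ → y)
map-proj₂ {X} {Y} {n} = recMap (SR-resp
  (SR-∃ (SR-N (app₂ pair pair-rec (app₂ pair pair-rec headʳ (app₁ π₁ π₁-rec k)) (app₁ π₂ π₂-rec k))))
  λ (x , y) w → N-×-extend₂ (space X) (space Y) (head w) x y)
  where
  k : Rec {2 + n} (λ u → head (tail u))
  k = headʳ ∘ʳ tailʳ

fun→map : ∀ {F : Point X → Vec ℕ n → ℕ} → RecFun X F → RecMap X ωᵘ F
fun→map F = recMap (SR-resp
  (SR-∃ (SR-× (SR-subst (graph F) (headʳ ∷ʳ tailʳ ∘ʳˢ tailʳ))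
              (SR-Z (Z-∘ (Balls.centre-rec ωᵘ) (headʳ ∷ʳ headʳ ∘ʳ tailʳ ∷ʳ []ʳ)))))
  λ x w → mk⇔ (λ h → _ , refl , h) (λ { (_ , refl , h) → h }))

map→fun : ∀ {F : Point X → Vec ℕ n → ℕ} → RecMap X ωᵘ F → RecFun X F
map→fun F = recFun (SR-resp
  (SR-subst (preimages F) (app₂ pair pair-rec headʳ (const (pair 1 0)) ∷ʳ tailʳ))
  λ x w → ω-ball (head w) _ ⇔-∘ mk⇔ sym sym)

-- Entry `j` is read off an approximation: an eventually zero sequence at distance less than 1/(j+1)
-- has the same entry there, and `code` supplies one.
apply : ∀ {f : Point X → Vec ℕ n → Baire} {F : Point X → Vec ℕ n → ℕ} → RecMap X 𝒩ᵘ f → RecFun X F →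
        RecFun X (λ x v → f x v (F x v))
apply {X} {n} {f} {F} rf rF = recFun (SR-resp (SR-plug at (fun-subst rF tailʳ)) (λ x w → mk⇔ id id))
  where
  at : Semirecursive X {2 + n} (λ x w → f x (tail (tail w)) (head w) ≡ head (tail w))
  at = SR-resp (SR-∃ (SR-guard (Z-≡ (app₂ entry entry-rec headʳ (headʳ ∘ʳ tailʳ)) (headʳ ∘ʳ tailʳ ∘ʳˢ tailʳ))
      (SR-subst (preimages rf) (app₂ pair pair-rec headʳ (app₂ pair pair-rec (const 1) (headʳ ∘ʳ tailʳ))
        ∷ʳ tailʳ ∘ʳˢ tailʳ ∘ʳˢ tailʳ))))
    λ { x (j ∷ m ∷ v) → let y = f x v in mk⇔
      (λ e → code y (suc j) , trans (entry-code y (suc j) j ≤-refl) e ,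
        from (N-ball 𝒩 (code y (suc j)) 1 j y)
          (from (𝒩-ball _ y j) λ k k≤j → entry-code y (suc j) k (s≤s k≤j)))
      (λ (i , e , h) → trans (sym (to (𝒩-ball _ y j) (to (N-ball 𝒩 i 1 j y) h) j ≤-refl)) e) }

-- The sequence is in `N k` iff it is in some ball inside `N k`, and membership in a ball fixes
-- finitely many entries: a bounded quantifier over the graph.
tabulateᴿ : ∀ {F : Point X → Vec ℕ (suc n) → ℕ} → RecFun X F → RecMap X 𝒩ᵘ (λ x v j → F x (j ∷ v))
tabulateᴿ {X} {n} {F} rF = recMap (SR-resp
  (SR-∃ (SR-guard (Z-∘ inside-rec (headʳ ∷ʳ headʳ ∘ʳ tailʳ ∷ʳ []ʳ))
    (SR-∀ (SR-subst (graph rF)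
        (app₂ entry entry-rec (app₁ π₁ π₁-rec (headʳ ∘ʳ tailʳ)) headʳ ∷ʳ headʳ ∷ʳ tailʳ ∘ʳˢ tailʳ ∘ʳˢ tailʳ))
      -- Radius 1/(s+1) fixes the entries 0 to s, hence the successor.
      (app₁ suc succ (app₁ π₂ π₂-rec headʳ)))))
  λ x w → let y = λ j → F x (j ∷ tail w) in mk⇔
    (λ h → let κ , a , c = refine y (π₂ (π₂ (head w))) in
      κ , c (head w) h ≤-refl , λ j j<s → sym (to (𝒩-ball _ y (π₂ κ)) a j (≤-pred j<s)))
    (λ (κ , c , e) → inside-sound κ (head w) c (from (𝒩-ball _ y (π₂ κ)) λ k k≤s → sym (e k (s≤s k≤s)))))
  where open Balls 𝒩ᵘ using (inside-rec; inside-sound; refine)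

fromΣ⁰₁ : ∀ {B} → Σ⁰₁ (space X) B → Semirecursive X {n} (λ x _ → B x)
fromΣ⁰₁ (ε , rε , B⊆ , ⊆B) = semirecursive (app₁ ε rε headʳ) (λ x v → mk⇔ B⊆ ⊆B)

toΣ⁰₁ : ∀ {P : Point X → Vec ℕ 0 → Set} → Semirecursive X P → Σ⁰₁ (space X) (λ x → P x [])
toΣ⁰₁ (semirecursive {ε} rec spec) =
  (λ t → ε (t ∷ [])) , rec ∘ʳ (headʳ ∷ʳ []ʳ) , to (spec _ []) , from (spec _ [])

fromRecursiveMap : ∀ {S : Shape} {f : Point X → Point S} →
                   RecursiveMap (space X) (space S) f → RecMap X S {n} (λ x _ → f x)
fromRecursiveMap {X} r = recMap (SR-preimage (fromΣ⁰₁ {X ×ᵘ ωᵘ} r) (map-, map-id (fun→map (fun-rec headʳ))))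

toRecursiveMap : ∀ {S : Shape} {f : Point X → Vec ℕ 0 → Point S} → RecMap X S f →
                 RecursiveMap (space X) (space S) (λ x → f x [])
toRecursiveMap {X} {S} {f} r = toΣ⁰₁ {X ×ᵘ ωᵘ} {λ (x , k) _ → f x [] ∈ N (space S) k} (SR-resp
  (SR-plug (SR-preimage (preimages r) map-proj₁) (map→fun map-proj₂))
  λ { (x , k) [] → mk⇔ id id })

-- The first entry of a code tells level 1 from higher levels. Copying it and choosing the tail by
-- it lets one total recursive map treat both kinds.
splice : ℕ → Baire → Baire → Baire
splice c b s zero    = c
splice c b s (suc i) = select c (b i) (s i)

map-splice : ∀ {c : Point X → Vec ℕ n → ℕ} {b s : Point X → Vec ℕ n → Baire} →
             RecFun X c → RecMap X 𝒩ᵘ b → RecMap X 𝒩ᵘ s →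
             RecMap X 𝒩ᵘ (λ x v → splice (c x v) (b x v) (s x v))
map-splice {X} {n} {c} {b} {s} rc rb rs = tabulateᴿ {F = F} (fun-resp
  (fun-select (fun-rec headʳ) (fun-subst rc tailʳ)
    (fun-select (fun-subst rc tailʳ) (at rb) (at rs)))
  λ { x (zero ∷ v) → refl ; x (suc i ∷ v) → refl })
  where
  F : Point X → Vec ℕ (suc n) → ℕ
  F x w = splice (c x (tail w)) (b x (tail w)) (s x (tail w)) (head w)
  -- `pred` undoes the shift by the first entry; at position 0 the value read is discarded.
  at : ∀ {f : Point X → Vec ℕ n → Baire} → RecMap X 𝒩ᵘ f → RecFun X (λ x w → f x (tail w) (pred (head w)))
  at rf = apply (map-subst rf tailʳ) (fun-rec (app₁ pred pred-rec headʳ))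

-- Sections and projections

-- Section 0 P is the projection of P along ω and Section (m + 1) P its
-- section at m, so that both are computed by a single recursion.
Section : ∀ {A : Set} → ℕ → Pred (ℕ × A) 0ℓ → Pred A 0ℓ
Section zero    P x = ∃[ m ] P (m , x)
Section (suc m) P x = P (m , x)

-- Zero exactly when `m` lies in the `ω` factor of the product ball; it never refers to `X`.
outside : ℕ → ℕ → ℕ
outside m k = ZeroSet.fun (Balls.centre-rec ωᵘ) (m ∷ fstᴺ k ∷ [])

-- Mode 0 imposes no condition. In mode m + 1 a neighbourhood whose first factor misses `m` is
-- replaced by index 0, the empty set.
sectionᴺ : ℕ → ℕ → ℕ
sectionᴺ n k = guard (unless n (outside (pred n) k)) (sndᴺ k)

sectionᴺ-rec : Recursive₂ sectionᴺ
sectionᴺ-rec = app₂ guard guard-rec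
  (app₂ unless unless-rec (proj 0F)
    (ZeroSet.rec (Balls.centre-rec ωᵘ) ∘ʳ
      (app₁ pred pred-rec (proj 0F) ∷ʳ app₁ fstᴺ fstᴺ-rec (proj 1F) ∷ʳ []ʳ)))
  (app₁ sndᴺ sndᴺ-rec (proj 1F))

section-N : ∀ X n k x → x ∈ N X (sectionᴺ n k) ⇔ x ∈ Section n (N (ω ×ˢ X) k)
section-N X zero k x = mk⇔
  -- The centre of the `ω` ball is a witness: the radius is positive because `x` lies in the other
  -- ball.
  (λ h → let u = to (N-pair X (π₂ (π₁ k)) (π₂ k) x) h in
    π₁ (π₁ k) , ω-near (π₁ (π₁ k)) (radius (π₂ k)) (Space.d-nonneg X _ x (radius (π₂ k)) u) , u)
  (λ (m , h) → proj₂ (to (N-× ω X k m x) h))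
section-N X (suc m) k x = mk⇔
  (λ h → let z , u = to (N-guard X (outside m k) (sndᴺ k) x) h in
    from (N-× ω X k m x) (from (ZeroSet.spec (Balls.centre-rec ωᵘ) (m ∷ fstᴺ k ∷ [])) z , u))
  (λ h → let a , u = to (N-× ω X k m x) h in
    from (N-guard X (outside m k) (sndᴺ k) x) (to (ZeroSet.spec (Balls.centre-rec ωᵘ) (m ∷ fstᴺ k ∷ [])) a , u))

-- The i-th term of the union Section n (⋃ⱼ ¬ Aⱼ) is ¬ Section (mode n i) (A (index n i)).
index mode : ℕ → ℕ → ℕ
index n i = select n (π₂ i) i
mode  n i = select n (suc (π₁ i)) n

index-rec : Recursive₂ index
index-rec = select-rec (proj 0F) (app₁ π₂ π₂-rec (proj 1F)) (proj 1F)

mode-rec : Recursive₂ mode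
mode-rec = select-rec (proj 0F) (app₁ suc succ (app₁ π₁ π₁-rec (proj 1F))) (proj 0F)

-- Complementation commutes with sections but not with projections; hence only positive modes occur
-- inside, and for the projection `i` codes both `m` and `j`.
section-¬ : ∀ {A : Set} (P : ℕ → Pred (ℕ × A) 0ℓ) (Q : ℕ → ℕ → Pred A 0ℓ) {x} →
            (∀ n j → x ∈ Q n j ⇔ x ∈ Section n (P j)) → ∀ n →
            (∃[ i ] x ∉ Q (mode n i) (index n i)) ⇔ x ∈ Section n (λ z → ∃[ j ] z ∉ P j)
section-¬ P Q {x} e zero = mk⇔
  (λ (i , h) → π₁ i , π₂ i , h ∘ from (e (suc (π₁ i)) (π₂ i)))
  (λ (m , j , h) → pair m j , λ q → h (subst₂ (λ m j → P j (m , x)) (π₁-pair m j) (π₂-pair m j)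
    (to (e (suc (π₁ (pair m j))) (π₂ (pair m j))) q)))
section-¬ P Q e (suc m) = mk⇔
  (λ (i , h) → i , h ∘ from (e (suc m) i))
  (λ (i , h) → i , h ∘ to (e (suc m) i))

-- This keeps the two clauses of `BC` apart, so that codes of the same level are all of one kind.
2≤ₒ⇒≰ₒ1 : ∀ {ξ} → 2ₒ ≤ₒ ξ → ¬ ξ ≤ₒ 1ₒ
2≤ₒ⇒≰ₒ1 (suc≤suc a) (suc≤suc b) = 1≤ₒ⇒≰ₒ0 a b
  where
  1≤ₒ⇒≰ₒ0 : ∀ {ξ} → 1ₒ ≤ₒ ξ → ¬ ξ ≤ₒ 0ₒ
  1≤ₒ⇒≰ₒ0 (≤sup n a) (sup≤ b) = 1≤ₒ⇒≰ₒ0 a (b n)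
2≤ₒ⇒≰ₒ1 (≤sup n a) (sup≤ b) = 2≤ₒ⇒≰ₒ1 a (b n)

Ω : Space
Ω = ω ×ˢ ω

splice-⋆-zero : ∀ {c} b s → c ≡ 0 → ∀ i → (splice c b s ⋆) i ≡ b i
splice-⋆-zero b s refl i rewrite +-comm i 1 = refl

splice-⋆-one : ∀ {c} b s → c ≡ 1 → ∀ i → (splice c b s ⋆) i ≡ s i
splice-⋆-one b s refl i rewrite +-comm i 1 = refl

-- Borel codes of sections and of projections.

module _ (𝔾 : GoodParametrization) where

  open GoodParametrization 𝔾

  -- The tails produced by `splice` agree with the codes from `S` only pointwise, and `G`, being
  -- `Σ⁰₁`, respects pointwise equality.
  Value-resp : ∀ X Y {γ γ′ x y} → γ ≗ γ′ → Value 𝔾 X Y γ x y → Value 𝔾 X Y γ′ x y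
  Value-resp X Y {γ} {γ′} {x} e v k = mk⇔
    (Σ⁰₁-resp (𝒩 ×ˢ X ×ˢ ω) (G-Σ⁰₁ (X ×ˢ ω)) {γ , x , k} {γ′ , x , k} (e , X-refl , refl) ∘ to (v k))
    (from (v k) ∘ Σ⁰₁-resp (𝒩 ×ˢ X ×ˢ ω) (G-Σ⁰₁ (X ×ˢ ω)) {γ′ , x , k} {γ , x , k} ((λ n → sym (e n)) , X-refl , refl))
    where X-refl = IsEquivalence.refl (Space.isEquivalence X)

  map-S : {e : Point X → Vec ℕ n → Baire} → RecMap X 𝒩ᵘ e →
          RecMap X 𝒩ᵘ (λ x v → S (type≤1 X) Ω (e x v , x))
  map-S {X} re = map-∘ (fromRecursiveMap {𝒩ᵘ ×ᵘ X} (S-recursive (type≤1 X) Ω)) (map-, re map-id)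

  SR-G : ∀ {γ : Point X → Vec ℕ n → Baire} {i k : Point X → Vec ℕ n → ℕ} →
         RecMap X 𝒩ᵘ γ → RecFun X i → RecFun X k →
         Semirecursive X (λ x v → (γ x v , i x v , k x v) ∈ G Ω)
  SR-G rγ ri rk = SR-preimage {P = λ z _ → z ∈ G Ω}
    (fromΣ⁰₁ {𝒩ᵘ ×ᵘ ωᵘ ×ᵘ ωᵘ} (G-Σ⁰₁ Ω)) (map-, rγ (map-, (fun→map ri) (fun→map rk)))

  -- The s-m-n theorem: a semirecursive family of relations between arguments and neighbourhood
  -- indices has a recursive index `e`, and `S` absorbs the point `x`.
  parametrize : {P : Point X → Vec ℕ 2 → Set} → Semirecursive X P →
                ∃[ e ] Recursive e × (∀ x i k → P x (i ∷ k ∷ []) ⇔ (S (type≤1 X) Ω (e , x) , i , k) ∈ G Ω)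
  parametrize {X} p =
    let e , re , P⊆ , ⊆P = to (Σ⁰₁⇔ (space X ×ˢ Ω) _) (toΣ⁰₁ {X ×ᵘ ωᵘ ×ᵘ ωᵘ}
          (SR-plug (SR-plug (SR-preimage p map-proj₁)
            (map→fun (map-∘ map-proj₁ map-proj₂))) (map→fun (map-∘ map-proj₂ map-proj₂))))
    in e , re , λ x i k → S-spec (type≤1 X) Ω e x (i , k) ⇔-∘ mk⇔ P⊆ ⊆P

  private
    X₀ : Shape
    X₀ = 𝒩ᵘ ×ᵘ 𝒩ᵘ ×ᵘ ωᵘ

  -- The W of the overview. The index `e` stays a variable here, because it is to describe a
  -- relation built from `section` itself.
  section : Point X₀ → Baire
  section x@(e , γ , n) = splice (γ 0) (λ i → sectionᴺ n (γ (i + 1))) (S (type≤1 X₀) Ω (e , x))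

  -- Kept abstract since its cover is a very large term.
  abstract
    map-section : RecMap X₀ 𝒩ᵘ {n} (λ x _ → section x)
    map-section = map-splice
      (apply γ (fun-rec (const 0)))
      (tabulateᴿ (fun-app₂ sectionᴺ sectionᴺ-rec mode₀ (apply γ (fun-rec (app₂ _+_ +-rec headʳ (const 1))))))
      (map-S map-proj₁)
      where
      γ : RecMap X₀ 𝒩ᵘ {n} (λ (_ , γ , _) _ → γ)
      γ = map-∘ map-proj₁ map-proj₂
      mode₀ : RecFun X₀ {n} (λ (_ , _ , n) _ → n)
      mode₀ = map→fun (map-∘ map-proj₂ map-proj₂)

  private
    module sec = Semirecursive (preimages (map-section {0}))

    -- With `v` listing `i` and `k`, this indexes the `t`-th basic set in the preimage of `N 𝒩 k`
    -- under `section`; `i` is dropped.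
    nbhd : ℕ → Vec ℕ 2 → ℕ
    nbhd t v = sec.cover (t ∷ tail v)

    nbhd-rec : Rec {3} (λ w → nbhd (head w) (tail w))
    nbhd-rec = sec.rec ∘ʳ (headʳ ∷ʳ tailʳ ∘ʳˢ tailʳ)

  -- The value {γ⋆}(j) enters only through its neighbourhoods, which G enumerates.
  Step : Point X₀ → Vec ℕ 2 → Set
  Step (e , γ , n) v = ∃[ t ]
    e ∈ N 𝒩 (fstᴺ (nbhd t v)) ×
    (γ ⋆ , index n (head v) , fstᴺ (sndᴺ (nbhd t v))) ∈ G Ω ×
    mode n (head v) ∈ N ω (sndᴺ (sndᴺ (nbhd t v)))

  Step-semirecursive : Semirecursive X₀ Step
  Step-semirecursive = SR-∃ (SR-×
    (SR-subst (preimages map-proj₁) (app₁ fstᴺ fstᴺ-rec nbhd-rec ∷ʳ []ʳ))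
    (SR-×
      (SR-G (tabulateᴿ (apply (map-∘ map-proj₁ map-proj₂) (fun-rec (app₂ _+_ +-rec headʳ (const 1)))))
        (fun-app₂ index index-rec mode₀ place) (fun-rec (app₁ fstᴺ fstᴺ-rec (app₁ sndᴺ sndᴺ-rec nbhd-rec))))
      (SR-subst (preimages (fun→map (fun-app₂ mode mode-rec mode₀ place)))
        (app₁ sndᴺ sndᴺ-rec (app₁ sndᴺ sndᴺ-rec nbhd-rec) ∷ʳ idʳ))))
    where
    mode₀ : RecFun X₀ {3} (λ (_ , _ , n) _ → n)
    mode₀ = map→fun (map-∘ map-proj₂ map-proj₂)
    place : RecFun X₀ {3} (λ _ w → head (tail w))
    place = fun-rec (headʳ ∘ʳ tailʳ)

  Step-value : ∀ {e γ n i δ} → Value 𝔾 ω 𝒩 (γ ⋆) (index n i) δ → ∀ k →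
               Step (e , γ , n) (i ∷ k ∷ []) ⇔ section (e , δ , mode n i) ∈ N 𝒩 k
  Step-value {e} {γ} {n} {i} {δ} val k = mk⇔
    (λ (t , a , b , c) → from (sec.spec x (k ∷ [])) (t ,
      from (N-× 𝒩 (𝒩 ×ˢ ω) (sec.cover (t ∷ k ∷ [])) e (δ , mode n i)) (a ,
        from (N-× 𝒩 ω (sndᴺ (sec.cover (t ∷ k ∷ []))) δ (mode n i)) (from (val (fstᴺ (sndᴺ (sec.cover (t ∷ k ∷ []))))) b , c))))
    (λ h → let t , h′ = to (sec.spec x (k ∷ [])) h
               a , h″ = to (N-× 𝒩 (𝒩 ×ˢ ω) (sec.cover (t ∷ k ∷ [])) e (δ , mode n i)) h′
               b , c  = to (N-× 𝒩 ω (sndᴺ (sec.cover (t ∷ k ∷ []))) δ (mode n i)) h″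
           in t , a , to (val (fstᴺ (sndᴺ (sec.cover (t ∷ k ∷ []))))) b , c)
    where
    x : Point X₀
    x = e , δ , mode n i

  step-code : ∃[ e ] Recursive e × (∀ x i k → Step x (i ∷ k ∷ []) ⇔ (S (type≤1 X₀) Ω (e , x) , i , k) ∈ G Ω)
  step-code = parametrize Step-semirecursive

  e₀ : Baire
  e₀ = proj₁ step-code

  -- Feeding the code e₀ of Step to itself makes section (e₀ , _ , _) satisfy
  -- its own recursion equation, as in the recursion theorem.
  section-value : ∀ n {γ i δ} → γ 0 ≡ 1 → Value 𝔾 ω 𝒩 (γ ⋆) (index n i) δ →
                  Value 𝔾 ω 𝒩 (section (e₀ , γ , n) ⋆) i (section (e₀ , δ , mode n i))
  section-value n {γ} {i} {δ} γ0≡1 val = Value-resp ω 𝒩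
    (λ j → sym (splice-⋆-one (λ i → sectionᴺ n (γ (i + 1))) (S (type≤1 X₀) Ω (e₀ , e₀ , γ , n)) γ0≡1 j))
    λ k → proj₂ (proj₂ step-code) (e₀ , γ , n) i k ⇔-∘ ⇔-sym (Step-value {e₀} {γ} {n} {i} {δ} val k)

  section-BC : ∀ n {ξ γ} → γ ∈ BC 𝔾 ξ → section (e₀ , γ , n) ∈ BC 𝔾 ξ
  section-BC n (base ξ≈1 z) = base ξ≈1 z
  -- Each new term is a section of an old term and keeps its level, so `ξ` does not grow.
  section-BC n {γ = γ} (step 2≤ξ z δ val η η< c) = step 2≤ξ z
    (λ i → section (e₀ , δ (index n i) , mode n i))
    (λ i → section-value n {γ} {i} z (val (index n i)))
    (λ i → η (index n i)) (λ i → η< (index n i))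
    (λ i → section-BC (mode n i) (c (index n i)))

  section-ρ : ∀ n {ξ γ} (p : γ ∈ BC 𝔾 ξ) X x → x ∈ ρ 𝔾 X (section-BC n p) ⇔ x ∈ Section n (ρ 𝔾 (ω ×ˢ X) p)
  section-ρ n {γ = γ} (base _ z) X x = commute n ⇔-∘ mk⇔
    (λ (i , h) → i , to (section-N X n ((γ ⋆) i) x) (subst (λ k → x ∈ N X k) (code≡ i) h))
    (λ (i , h) → i , subst (λ k → x ∈ N X k) (sym (code≡ i)) (from (section-N X n ((γ ⋆) i) x) h))
    where
    code≡ : ∀ i → (section (e₀ , γ , n) ⋆) i ≡ sectionᴺ n ((γ ⋆) i)
    code≡ = splice-⋆-zero (λ i → sectionᴺ n (γ (i + 1))) (S (type≤1 X₀) Ω (e₀ , e₀ , γ , n)) z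
    commute : ∀ n → (∃[ i ] x ∈ Section n (N (ω ×ˢ X) ((γ ⋆) i))) ⇔
              x ∈ Section n (λ y → ∃[ i ] y ∈ N (ω ×ˢ X) ((γ ⋆) i))
    commute zero    = mk⇔ (λ (i , m , h) → m , i , h) (λ (m , i , h) → i , m , h)
    commute (suc m) = mk⇔ id id
  section-ρ n (step _ _ _ _ _ _ c) X x = section-¬
    (λ j → ρ 𝔾 (ω ×ˢ X) (c j)) (λ n j → ρ 𝔾 X (section-BC n (c j))) (λ n j → section-ρ n (c j) X x) n

  projection : Baire → Baire
  projection γ = section (e₀ , γ , 0)

  projection-recursive : RecursiveMap 𝒩 𝒩 projection
  projection-recursive = toRecursiveMap {𝒩ᵘ} {𝒩ᵘ} (map-∘ map-section
    (map-, (tabulateᴿ (fun-rec (app₁ e₀ (proj₁ (proj₂ step-code)) headʳ)))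
      (map-, map-id (fun→map (fun-rec (const 0))))))

  -- Countable unions

  union-code : ∃[ e ] Recursive e × (∀ γ i k →
    ((γ ⟨ π₁ i ⟩) ⋆ , π₂ i , k) ∈ G Ω ⇔ (S (type≤1 𝒩ᵘ) Ω (e , γ) , i , k) ∈ G Ω)
  union-code = parametrize {𝒩ᵘ} {λ γ v → ((γ ⟨ π₁ (head v) ⟩) ⋆ , π₂ (head v) , head (tail v)) ∈ G Ω}
    (SR-G
    (tabulateᴿ (apply map-id (fun-rec (app₂ pair pair-rec (app₁ π₁ π₁-rec (headʳ ∘ʳ tailʳ))
      (app₂ _+_ +-rec headʳ (const 1))))))
    (fun-rec (app₁ π₂ π₂-rec headʳ)) (fun-rec (headʳ ∘ʳ tailʳ)))

  e₁ : Baire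
  e₁ = proj₁ union-code

  -- `pair 0 0` is 0, so `γ 0` is the first entry of `γ ⟨ 0 ⟩` and shows the kind of that code,
  -- which the other codes of the same level share.
  union-base union : Baire → Baire
  union-base γ i = ((γ ⟨ π₁ i ⟩) ⋆) (π₂ i)
  union γ = splice (γ 0) (union-base γ) (S (type≤1 𝒩ᵘ) Ω (e₁ , γ))

  union-recursive : RecursiveMap 𝒩 𝒩 union
  union-recursive = toRecursiveMap {𝒩ᵘ} {𝒩ᵘ} (map-splice
    (apply map-id (fun-rec (const 0)))
    (tabulateᴿ (apply map-id (fun-rec (app₂ pair pair-rec (app₁ π₁ π₁-rec headʳ)
      (app₂ _+_ +-rec (app₁ π₂ π₂-rec headʳ) (const 1))))))
    (map-S (tabulateᴿ (fun-rec (app₁ e₁ (proj₁ (proj₂ union-code)) headʳ)))))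

  union-value : ∀ {γ i δ} → γ 0 ≡ 1 → Value 𝔾 ω 𝒩 ((γ ⟨ π₁ i ⟩) ⋆) (π₂ i) δ → Value 𝔾 ω 𝒩 (union γ ⋆) i δ
  union-value {γ} {i} γ0≡1 val = Value-resp ω 𝒩
    (λ j → sym (splice-⋆-one (union-base γ) (S (type≤1 𝒩ᵘ) Ω (e₁ , γ)) γ0≡1 j))
    λ k → proj₂ (proj₂ union-code) γ i k ⇔-∘ val k

  ρ-base : ∀ {ξ γ} → ξ ≈ₒ 1ₒ → (p : γ ∈ BC 𝔾 ξ) → ∀ X x → x ∈ ρ 𝔾 X p ⇔ (∃[ i ] x ∈ N X ((γ ⋆) i))
  ρ-base ξ≈1 (base _ _)            X x = mk⇔ id id
  ρ-base ξ≈1 (step 2≤ξ _ _ _ _ _ _) X x = contradiction (proj₁ ξ≈1) (2≤ₒ⇒≰ₒ1 2≤ξ)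

  -- Inverting each derivation once gives the terms and levels of the `n`-th code as functions of
  -- `n`, which can then be listed along `pair`.
  record Composite {ξ γ} (p : γ ∈ BC 𝔾 ξ) : Set₁ where
    field
      one    : γ 0 ≡ 1
      terms  : ℕ → Baire
      values : ∀ i → Value 𝔾 ω 𝒩 (γ ⋆) i (terms i)
      levels : ℕ → ω₁
      bounds : ∀ i → 1ₒ ≤ₒ levels i × levels i <ₒ ξ
      codes  : ∀ i → terms i ∈ BC 𝔾 (levels i)
      ρ-step : ∀ X x → x ∈ ρ 𝔾 X p ⇔ (∃[ i ] x ∉ ρ 𝔾 X (codes i))

  composite : ∀ {ξ γ} → 2ₒ ≤ₒ ξ → (p : γ ∈ BC 𝔾 ξ) → Composite p
  composite 2≤ξ (base ξ≈1 _) = contradiction (proj₁ ξ≈1) (2≤ₒ⇒≰ₒ1 2≤ξ)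
  composite 2≤ξ (step _ z δ val η η< c) = record
    { one = z ; terms = δ ; values = val ; levels = η ; bounds = η< ; codes = c
    ; ρ-step = λ X x → mk⇔ id id }

  union-BC : ∀ {ξ γ} (p : ∀ n → γ ⟨ n ⟩ ∈ BC 𝔾 ξ) → Σ[ q ∈ (union γ ∈ BC 𝔾 ξ) ]
             (∀ X x → x ∈ ρ 𝔾 X q ⇔ (∃[ n ] x ∈ ρ 𝔾 X (p n)))
  union-BC {ξ} {γ} p = by-level (p 0)
    where
    Goal : Set₁
    Goal = Σ[ q ∈ (union γ ∈ BC 𝔾 ξ) ] (∀ X x → x ∈ ρ 𝔾 X q ⇔ (∃[ n ] x ∈ ρ 𝔾 X (p n)))

    base-case : ξ ≈ₒ 1ₒ → γ 0 ≡ 0 → Goal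
    base-case ξ≈1 z = base ξ≈1 z , λ X x → mk⇔
      (λ (i , h) → π₁ i , from (ρ-base ξ≈1 (p (π₁ i)) X x) (π₂ i , subst (λ k → x ∈ N X k) (code≡ i) h))
      (λ (n , h) → let j , h′ = to (ρ-base ξ≈1 (p n) X x) h in pair n j ,
        subst (λ k → x ∈ N X k) (sym (trans (code≡ (pair n j))
          (cong₂ (λ n j → ((γ ⟨ n ⟩) ⋆) j) (π₁-pair n j) (π₂-pair n j)))) h′)
      where
      code≡ : ∀ i → (union γ ⋆) i ≡ union-base γ i
      code≡ = splice-⋆-zero (union-base γ) (S (type≤1 𝒩ᵘ) Ω (e₁ , γ)) z

    step-case : 2ₒ ≤ₒ ξ → γ 0 ≡ 1 → Goal
    step-case 2≤ξ z = step 2≤ξ z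
        (λ i → c.terms (π₁ i) (π₂ i))
        (λ i → union-value {γ} {i} z (c.values (π₁ i) (π₂ i)))
        (λ i → c.levels (π₁ i) (π₂ i)) (λ i → c.bounds (π₁ i) (π₂ i)) (λ i → c.codes (π₁ i) (π₂ i)) ,
      λ X x → mk⇔
        (λ (i , h) → π₁ i , from (c.ρ-step (π₁ i) X x) (π₂ i , h))
        (λ (n , h) → let j , h′ = to (c.ρ-step n X x) h in pair n j ,
          subst₂ (λ n j → x ∉ ρ 𝔾 X (c.codes n j)) (sym (π₁-pair n j)) (sym (π₂-pair n j)) h′)
      where module c n = Composite (composite 2≤ξ (p n))

    by-level : γ ⟨ 0 ⟩ ∈ BC 𝔾 ξ → Goal
    by-level (base ξ≈1 z)           = base-case ξ≈1 z
    by-level (step 2≤ξ z _ _ _ _ _) = step-case 2≤ξ z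

lemma3p6 : (𝔾 : GoodParametrization) →
    (∃[ u ] RecursiveMap 𝒩 𝒩 u ×
    (∀ ξ → 1ₒ ≤ₒ ξ → ∀ γ (p : γ ∈ BC 𝔾 ξ) →
    Σ[ q ∈ (u γ ∈ BC 𝔾 ξ) ]
    (∀ X x → x ∈ ρ 𝔾 X q ⇔ (∃[ n ] (n , x) ∈ ρ 𝔾 (ω ×ˢ X) p)))) ×
    (∃[ u ] RecursiveMap 𝒩 𝒩 u ×
    (∀ ξ → 1ₒ ≤ₒ ξ → ∀ γ (p : ∀ n → γ ⟨ n ⟩ ∈ BC 𝔾 ξ) →
    Σ[ q ∈ (u γ ∈ BC 𝔾 ξ) ]
    (∀ X x → x ∈ ρ 𝔾 X q ⇔ (∃[ n ] x ∈ ρ 𝔾 X (p n)))))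
lemma3p6 𝔾 =
  (projection 𝔾 , projection-recursive 𝔾 , λ ξ _ γ p → section-BC 𝔾 0 p , section-ρ 𝔾 0 p) ,
  (union 𝔾 , union-recursive 𝔾 , λ ξ _ γ p → union-BC 𝔾 p)
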